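{- Let $m,n\ge1$. For every marked EW-tableau $M=(T,a)\in\mathsf{MEW}_{m,n}$ there is exactly one $D\in\mathsf{LPara}_{m,n}$ with $B(D)=\phi(T)$ and $\mathsf{surp}(D)=\zeta$, where $\zeta=(\zeta_1,\dots,\zeta_{m+n-1})$ and $\zeta_i=\eta_i(T)-a_i-1$; writing $\Phi(M)$ for this $D$, the map $\Phi:\mathsf{MEW}_{m,n}\to\mathsf{LPara}_{m,n}$ is a bijection.
   Context: All tableaux are $0/1$ arrays; $T_{ij}$ is the entry in row $i$ (top to bottom), column $j$ (left to right). Labels are symbols $v_0,\dots,v_{m+n-1}$ ordered by $v_i<v_j$ iff $i<j$. EW-tableaux: $\mathsf{EW}_{m,n}$ is the set of $m\times n$ $0/1$ tableaux $T$ whose top row is all $1$s, every other row contains a $0$, and with no rows $i\ne i'$, columns $k\ne k'$ such that $T_{ik}=T_{i'k'}=0$, $T_{ik'}=T_{i'k}=1$. Rows are labelled $v_0,\dots,v_{m-1}$ top to bottom, columns $v_m,\dots,v_{m+n-1}$ left to right. An entry $x=T_{jk}$ is cornersupport if there are $j'\ne j$, $k'\ne k$ with $T_{j'k'}=1-x$ and $T_{j'k}=T_{jk'}=x$. For $1\le i\le m-1$, $\eta_i(T)$ is the number of non-cornersupport $0$s in the row labelled $v_i$; for $m\le i\le m+n-1$, $\eta_i(T)$ is the number of non-cornersupport $1$s in the column labelled $v_i$. $\mathsf{MEW}_{m,n}$ is the set of pairs $(T,a)$ with $T\in\mathsf{EW}_{m,n}$ and $a=(a_1,\dots,a_{m+n-1})$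 integers with $0\le a_i\le\eta_i(T)-1$ (equivalently, in each row $v_i$, $i\ge1$, the $(a_i+1)$-th non-cornersupport $0$ from the left is marked, and in each column $v_i$ the $(a_i+1)$-th non-cornersupport $1$ from the top is marked). Parallelogram polyomino of type $(m,n)$: an $m\times n$ $0/1$ tableau $P$ with $P_{11}=P_{mn}=1$, every row containing at least one $1$ with the $1$s of each row contiguous, and for each $2\le i\le m$: the leftmost $1$ of row $i$ is weakly right of the leftmost $1$ of row $i-1$ and weakly left of the rightmost $1$ of row $i-1$, and the rightmost $1$ of row $i$ is weakly right of that of row $i-1$. Ribbon: exactly $m+n-1$ ones. Labelled parallelogram polyomino: $(P,\ell)$ with row labels a permutation of $\{v_0,\dots,v_{m-1}\}$, top row labelled $v_0$, labels of rows whose leftmost $1$s lie in the same column increasing top to bottom; column labels a permutation of $\{v_m,\dots,v_{m+n-1}\}$, labels of columns whose topmost $1$s lie in the same row increasing left to right. $\mathsf{LPara}_{m,n}$ is the set of these and $\mathsf{LRib}_{m,n}$ the subset with ribbon $P$. The map $\phi:\mathsf{EW}_{m,n}\to\mathsf{LRib}_{m,n}$: permute the columns of $T$ (with labels) so every entry left of a $0$ is $0$, identical columns with labels increasing left to right; then permute rows so every entry above a $1$ is $1$, identical rows with labels increasing top to bottom; get $T'$ with labelling $\ell$. Let $R_{ij}=1$ iff [$T'_{ij}=1$ and ($i=m$ or $T'_{i+1,j}=0$)] or [$T'_{ij}=0$ and ($j=n$ or $T'_{i,j+1}=1$)]. Then $\phi(T)=(R,\ell)$. Bounce: $\mathrm{bounce}(P)$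 is the $0/1$ tableau whose $1$s are the cells visited by the path starting at $(1,1)$, moving right to the rightmost $1$ of the current row, then down to the lowest $1$ of the current column, alternating until reaching $(m,n)$. For $D=(P,\ell)\in\mathsf{LPara}_{m,n}$, $B(D)=(\mathrm{bounce}(P),\ell')$ where $\ell'$ gives each maximal block of consecutive rows whose leftmost $1$ in $\mathrm{bounce}(P)$ lies in the same column the same set of labels as $\ell$ gives those rows, arranged increasingly top to bottom, and each maximal block of consecutive columns whose topmost $1$ in $\mathrm{bounce}(P)$ lies in the same row the set of labels $\ell$ gives them, increasingly left to right. $\mathsf{surp}(D)=(\mathsf{surp}_1,\dots,\mathsf{surp}_{m+n-1})$: for $1\le i\le m-1$, the column index of the leftmost $1$ of the row labelled $v_i$ in $B(D)$ minus that in $D$; for $m\le i\le m+n-1$, the row index of the topmost $1$ of the column labelled $v_i$ in $B(D)$ minus that in $D$. -}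

module Defs where

open import Data.Nat using (ℕ; zero; suc; _+_; _∸_; _≤_; _<_; _⊓_; _⊔_; _≡ᵇ_; _<ᵇ_; _≤ᵇ_)
open import Data.Integer using (ℤ; +_) renaming (_-_ to _-ℤ_)
open import Data.Bool using (Bool; true; false; not; _∧_; _∨_; if_then_else_)
open import Data.Vec using (Vec; []; _∷_; tabulate; replicate)
open import Data.Fin using (Fin; toℕ)
open import Data.Product using (Σ; ∃; _×_; proj₁; proj₂; _,_)
open import Data.Empty using (⊥)
open import Relation.Binary.PropositionalEquality using (_≡_; _≢_)

-- Conventions.
-- All row / column indices are 0-based natural numbers (row i of the
-- paper is index i-1 here); differences of indices are unaffected.
-- A label v_k is represented by the natural number k.
-- A tableau of size m×n is a vector of m rows, each a vector of n Bools
-- (true = 1, false = 0).  Out-of-range accesses return a default value,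
-- but all definitions below only quantify over in-range indices.

Mat : ℕ → ℕ → Set
Mat m n = Vec (Vec Bool n) m

vget : ∀ {A : Set} {k} → A → Vec A k → ℕ → A
vget d []       _       = d
vget d (x ∷ xs) zero    = x
vget d (x ∷ xs) (suc i) = vget d xs i

ent : ∀ {m n} → Mat m n → ℕ → ℕ → Bool
ent {m} {n} T i j = vget false (vget (replicate n false) T i) j

vat : ∀ {k} → Vec ℕ k → ℕ → ℕ
vat = vget 0

mkMat : ∀ {m n} → (ℕ → ℕ → Bool) → Mat m n
mkMat f = tabulate (λ i → tabulate (λ j → f (toℕ i) (toℕ j)))

beq : Bool → Bool → Bool
beq true  b = b
beq false b = not b

-- least t < k with p t (k if none)
firstTrue : ℕ → (ℕ → Bool) → ℕ
firstTrue zero    p = zero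
firstTrue (suc k) p = if p 0 then 0 else suc (firstTrue k (λ t → p (suc t)))

-- greatest t < k with p t (0 if none)
lastTrue : ℕ → (ℕ → Bool) → ℕ
lastTrue zero    p = zero
lastTrue (suc k) p = if p k then k else lastTrue k p

countN : ℕ → (ℕ → Bool) → ℕ
countN zero    p = zero
countN (suc k) p = (if p k then 1 else 0) + countN k p

anyN : ℕ → (ℕ → Bool) → Bool
anyN zero    p = false
anyN (suc k) p = p k ∨ anyN k p

module _ {m n : ℕ} (P : Mat m n) where
  leftmost rightmost topmost lowest : ℕ → ℕ
  leftmost  i = firstTrue n (λ j → ent P i j)
  rightmost i = lastTrue  n (λ j → ent P i j)
  topmost   j = firstTrue m (λ i → ent P i j)
  lowest    j = lastTrue  m (λ i → ent P i j)

IsEW : ∀ {m n} → Mat m n → Set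
IsEW {m} {n} T =
  (∀ k → k < n → ent T 0 k ≡ true)
  × (∀ i → 1 ≤ i → i < m → ∃ λ k → k < n × ent T i k ≡ false)
  × (∀ i i' k k' → i < m → i' < m → k < n → k' < n → i ≢ i' → k ≢ k' →
       ent T i k ≡ false → ent T i' k' ≡ false →
       ent T i k' ≡ true → ent T i' k ≡ true → ⊥)

cornersupport : ∀ {m n} → Mat m n → ℕ → ℕ → Bool
cornersupport {m} {n} T j k =
  anyN m (λ j' → anyN n (λ k' →
    not (j' ≡ᵇ j) ∧ not (k' ≡ᵇ k) ∧
    beq (ent T j' k') (not (ent T j k)) ∧
    beq (ent T j' k) (ent T j k) ∧ beq (ent T j k') (ent T j k)))

-- η_i(T); rows labelled v_0..v_{m-1}, columns v_m..v_{m+n-1} (in order).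
-- Value 0 outside 1 ≤ i ≤ m+n-1 (never used there).
eta : ∀ {m n} → Mat m n → ℕ → ℕ
eta {m} {n} T i =
  if (1 ≤ᵇ i) ∧ (i <ᵇ m)
  then countN n (λ k → not (ent T i k) ∧ not (cornersupport T i k))
  else if (m ≤ᵇ i) ∧ (i <ᵇ m + n)
  then countN m (λ j → ent T j (i ∸ m) ∧ not (cornersupport T j (i ∸ m)))
  else 0

-- Marked EW-tableaux: a = (a_1,...,a_{m+n-1}); entry p of the vector is a_{p+1}.
MEWData : ℕ → ℕ → Set
MEWData m n = Mat m n × Vec ℕ (m + n ∸ 1)

aget : ∀ {k} → Vec ℕ k → Fin k → ℕ
aget []       ()
aget (x ∷ xs) Fin.zero    = x
aget (x ∷ xs) (Fin.suc p) = aget xs p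

IsMEW : ∀ {m n} → MEWData m n → Set
IsMEW {m} {n} (T , a) =
  IsEW T × (∀ (p : Fin (m + n ∸ 1)) → suc (aget a p) ≤ eta T (suc (toℕ p)))

MEW : ℕ → ℕ → Set
MEW m n = Σ (MEWData m n) IsMEW

zeta : ∀ {m n} → MEWData m n → Fin (m + n ∸ 1) → ℕ
zeta (T , a) p = eta T (suc (toℕ p)) ∸ aget a p ∸ 1

-- Labellings: row i gets label (vat rl i), column j gets label (vat cl j).

Labelling : ℕ → ℕ → Set
Labelling m n = Vec ℕ m × Vec ℕ n

IsPermFrom : ∀ {k} → ℕ → Vec ℕ k → Set
IsPermFrom {k} base v =
  (∀ i → i < k → base ≤ vat v i × vat v i < base + k)
  × (∀ i i' → i < k → i' < k → vat v i ≡ vat v i' → i ≡ i')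

IsLabelling : ∀ {m n} → Labelling m n → Set
IsLabelling {m} {n} (rl , cl) = IsPermFrom 0 rl × IsPermFrom m cl

LabPoly : ℕ → ℕ → Set
LabPoly m n = Mat m n × Labelling m n

IsParaPoly : ∀ {m n} → Mat m n → Set
IsParaPoly {m} {n} P =
  ent P 0 0 ≡ true × ent P (m ∸ 1) (n ∸ 1) ≡ true
  × (∀ i → i < m → ∃ λ j → j < n × ent P i j ≡ true)
  × (∀ i j₁ j j₂ → i < m → j₁ ≤ j → j ≤ j₂ → j₂ < n →
       ent P i j₁ ≡ true → ent P i j₂ ≡ true → ent P i j ≡ true)
  × (∀ i → suc i < m →
       leftmost P i ≤ leftmost P (suc i)
       × leftmost P (suc i) ≤ rightmost P i
       × rightmost P i ≤ rightmost P (suc i))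

IsLPara : ∀ {m n} → LabPoly m n → Set
IsLPara {m} {n} (P , (rl , cl)) =
  IsParaPoly P × IsLabelling (rl , cl) × vat rl 0 ≡ 0
  × (∀ i i' → i < i' → i' < m → leftmost P i ≡ leftmost P i' → vat rl i < vat rl i')
  × (∀ j j' → j < j' → j' < n → topmost P j ≡ topmost P j' → vat cl j < vat cl j')

-- The map φ, as the (unique) result of the sorting procedure.
-- Row i of T' is row (vat rl i) of T (its label is v_{vat rl i});
-- column j of T' is column (vat cl j ∸ m) of T (label v_{vat cl j}).

IsPhi : ∀ {m n} → Mat m n → LabPoly m n → Set
IsPhi {m} {n} T (R , (rl , cl)) =
  IsLabelling (rl , cl)
  × (∀ i j' j → i < m → j' < j → j < n → T₁ i j ≡ false → T₁ i j' ≡ false)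
  × (∀ j j' → j < j' → j' < n → (∀ i → i < m → T₁ i j ≡ T₁ i j') → vat cl j < vat cl j')
  × (∀ i' i j → i' < i → i < m → j < n → T' i j ≡ true → T' i' j ≡ true)
  × (∀ i i' → i < i' → i' < m → (∀ j → j < n → T' i j ≡ T' i' j) → vat rl i < vat rl i')
  × R ≡ mkMat rule
  where
  T₁ : ℕ → ℕ → Bool
  T₁ i j = ent T i (vat cl j ∸ m)
  T' : ℕ → ℕ → Bool
  T' i j = T₁ (vat rl i) j
  rule : ℕ → ℕ → Bool
  rule i j = (T' i j ∧ ((suc i ≡ᵇ m) ∨ not (T' (suc i) j)))
           ∨ (not (T' i j) ∧ ((suc j ≡ᵇ n) ∨ T' i (suc j)))

module _ {m n : ℕ} (P : Mat m n) where
  -- is cell (i , j) visited by the path when it is at (r , c), about to move right?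
  walk : ℕ → ℕ → ℕ → ℕ → ℕ → Bool
  walk zero    r c i j = (i ≡ᵇ r) ∧ (j ≡ᵇ c)
  walk (suc f) r c i j =
    ((i ≡ᵇ r) ∧ (c ≤ᵇ j) ∧ (j ≤ᵇ c'))
    ∨ ((j ≡ᵇ c') ∧ (r ≤ᵇ i) ∧ (i ≤ᵇ r'))
    ∨ walk f r' c' i j
    where
    c' = rightmost P r
    r' = lowest P c'

  -- (m + n steps suffice to reach (m-1, n-1) for a parallelogram polyomino)
  bounce : Mat m n
  bounce = mkMat (walk (m + n) 0 0)

SameRun : (ℕ → ℕ) → ℕ → ℕ → Set
SameRun f i i' = ∀ t → i ⊓ i' ≤ t → t ≤ i ⊔ i' → f t ≡ f i

IsBLab : ∀ {m n} → LabPoly m n → Labelling m n → Set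
IsBLab {m} {n} (P , (rl , cl)) (rl' , cl') =
  (∀ i → i < m → ∃ λ i' → i' < m × SameRun f i i' × vat rl' i ≡ vat rl i')
  × (∀ i → i < m → ∃ λ i' → i' < m × SameRun f i i' × vat rl i ≡ vat rl' i')
  × (∀ i i' → i < i' → i' < m → SameRun f i i' → vat rl' i < vat rl' i')
  × (∀ j → j < n → ∃ λ j' → j' < n × SameRun g j j' × vat cl' j ≡ vat cl j')
  × (∀ j → j < n → ∃ λ j' → j' < n × SameRun g j j' × vat cl j ≡ vat cl' j')
  × (∀ j j' → j < j' → j' < n → SameRun g j j' → vat cl' j < vat cl' j')
  where
  f = leftmost (bounce P)
  g = topmost (bounce P)

IsB : ∀ {m n} → LabPoly m n → LabPoly m n → Set
IsB (P , ℓ) (Q , ℓ') = Q ≡ bounce P × IsBLab (P , ℓ) ℓ'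

-- surp_i(D), given E = B(D); for 1 ≤ i ≤ m+n-1
surp : ∀ {m n} → LabPoly m n → LabPoly m n → ℕ → ℤ
surp {m} {n} (P , (rl , cl)) (Q , (rl' , cl')) i =
  if i <ᵇ m
  then (+ leftmost Q (rowOf rl' i)) -ℤ (+ leftmost P (rowOf rl i))
  else (+ topmost Q (colOf cl' i)) -ℤ (+ topmost P (colOf cl i))
  where
  rowOf : Vec ℕ m → ℕ → ℕ
  rowOf l k = firstTrue m (λ r → vat l r ≡ᵇ k)
  colOf : Vec ℕ n → ℕ → ℕ
  colOf l k = firstTrue n (λ j → vat l j ≡ᵇ k)

Spec : ∀ {m n} → MEWData m n → LabPoly m n → Set
Spec {m} {n} (T , a) D =
  Σ (LabPoly m n) λ E →
    IsB D E × IsPhi T E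
    × (∀ (p : Fin (m + n ∸ 1)) → surp D E (suc (toℕ p)) ≡ + zeta (T , a) p)

{-# OPTIONS --safe #-}

-- Let Z x be the number of zeros in row x of T and H y the number of ones in column y.
-- The non-cornersupport zeros of row x number Z x minus the next smaller row value Z⁻ x, and
-- similarly for columns. In φ(T) the row labelled x ≥ 1 starts at column Z x - 1
-- (counted from 0), so prescribing the surplus ζ amounts to prescribing that the row labelled
-- x of D starts at column L x = Z⁻ x + a x, and the column labelled y at row U y = H⁻ y + a y,
-- with Z⁻ x ≤ L x < Z x and H⁻ y ≤ U y < H y. A labelled polyomino is determined by (L , U):
-- its rows and columns are sorted by start, with ties broken by label. The inequalities say
-- exactly that the bounce path of this polyomino is φ(T), and (L , U) recovers T by
-- burning: T has a 1 where the row burns before the column.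

module Submission where

open import Defs
open import Data.Bool using (Bool; true; false; not; _∧_; _∨_; if_then_else_)
open import Data.Bool.Properties using (T-≡; ⇔→≡; ∧-conicalˡ; ∧-conicalʳ)
open import Data.Empty using (⊥; ⊥-elim)
open import Data.Fin using (Fin; toℕ; fromℕ<)
open import Data.Fin.Properties using (toℕ-fromℕ<; toℕ<n)
import Data.Integer as ℤ
import Data.Integer.Properties as ℤ
open import Algebra.Properties.AbelianGroup ℤ.+-0-abelianGroup using (//-rightDividesˡ; //-rightDividesʳ)
open import Data.Nat using (ℕ; zero; suc; _+_; _∸_; _≤_; _<_; _≡ᵇ_; _<ᵇ_; _≤ᵇ_; z≤n; s≤s; z<s)
open import Data.Nat.Properties
open import Data.Product using (Σ; ∃; _×_; proj₁; proj₂; _,_)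
open import Data.Sum using (_⊎_; inj₁; inj₂)
open import Data.Vec using (Vec; []; _∷_; tabulate; replicate)
open import Function using (_⇔_; mk⇔; Equivalence; id; _∘_)
open import Relation.Binary.Definitions using (tri<; tri≈; tri>)
open import Relation.Binary.PropositionalEquality
open import Relation.Nullary using (¬_; yes; no; contradiction)

open Equivalence using (to; from)

-- Why `Z⁻` appears: the zero sets of two rows of `T` are comparable by inclusion, and a zero of row
-- `x` is cornersupport exactly when it lies in a strictly smaller zero set. So the cornersupport
-- zeros of `x` number `Z⁻ x`, `η` is the gap from `Z⁻` to `Z`, and the start `Z - 1 - ζ` equals
-- `Z⁻ + a`. Why the marks do not affect the bounce path: a column with at most `r + 1` ones starts
-- at or above row `r`, while a column with `H⁻ ≥ r + 1` starts below it. Each leg therefore ends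
-- where a block of equal sizes ends, wherever in their gaps the starts lie. The same gaps govern
-- burning: if `r` is itself a column size, then `U y < r` exactly when `H y ≤ r`. The set burnt in
-- each round is thus visible in `T`, which gives injectivity. For surjectivity, the overlap of
-- consecutive rows of a polyomino is what keeps the fire from stalling. Rows and columns differ in
-- one point: row 0 has no zeros and no mark, and serves as the root of the burning.

≤ᵇ⇔ : ∀ {a b} → (a ≤ᵇ b) ≡ true ⇔ a ≤ b
≤ᵇ⇔ {a} {b} = mk⇔ (λ e → ≤ᵇ⇒≤ a b (from T-≡ e)) (λ p → to T-≡ (≤⇒≤ᵇ p))

<ᵇ⇔ : ∀ {a b} → (a <ᵇ b) ≡ true ⇔ a < b
<ᵇ⇔ {a} {b} = mk⇔ (λ e → <ᵇ⇒< a b (from T-≡ e)) (λ p → to T-≡ (<⇒<ᵇ p))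

≡ᵇ⇔ : ∀ {a b} → (a ≡ᵇ b) ≡ true ⇔ a ≡ b
≡ᵇ⇔ {a} {b} = mk⇔ (λ e → ≡ᵇ⇒≡ a b (from T-≡ e)) (λ p → to T-≡ (≡⇒≡ᵇ a b p))

∧⇔ : ∀ {a b} → a ∧ b ≡ true ⇔ (a ≡ true × b ≡ true)
∧⇔ {a} {b} = mk⇔ (λ e → ∧-conicalˡ a b e , ∧-conicalʳ a b e) (λ { (refl , refl) → refl })

∨⇔ : ∀ {a b} → a ∨ b ≡ true ⇔ (a ≡ true ⊎ b ≡ true)
∨⇔ {true}  = mk⇔ inj₁ (λ _ → refl)
∨⇔ {false} = mk⇔ inj₂ (λ { (inj₁ ()) ; (inj₂ e) → e })

not⇔ : ∀ {a} → not a ≡ true ⇔ a ≡ false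
not⇔ {true}  = mk⇔ (λ ()) (λ ())
not⇔ {false} = mk⇔ (λ _ → refl) (λ _ → refl)

beq⇔ : ∀ {a b} → beq a b ≡ true ⇔ a ≡ b
beq⇔ {true}  = mk⇔ sym sym
beq⇔ {false} {true} = mk⇔ (λ ()) (λ ())
beq⇔ {false} {false} = mk⇔ (λ _ → refl) (λ _ → refl)

¬true⇒false : ∀ {b} → ¬ (b ≡ true) → b ≡ false
¬true⇒false {true}  f = contradiction refl f
¬true⇒false {false} f = refl

false⇒¬true : ∀ {b} → b ≡ false → ¬ (b ≡ true)
false⇒¬true refl ()

dichotomy : ∀ b → b ≡ true ⊎ b ≡ false
dichotomy true  = inj₁ refl
dichotomy false = inj₂ refl

bool-ext : ∀ {a b} → (a ≡ true → b ≡ true) → (b ≡ true → a ≡ true) → a ≡ b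
bool-ext f g = ⇔→≡ (mk⇔ f g)

-- Bounded search

anyN⇔ : ∀ {k p} → anyN k p ≡ true ⇔ (∃ λ i → i < k × p i ≡ true)
anyN⇔ = mk⇔ (fwd _ _) (λ { (i , i< , e) → bwd _ _ i i< e })
  where
  fwd : ∀ k (p : ℕ → Bool) → anyN k p ≡ true → ∃ λ i → i < k × p i ≡ true
  fwd (suc k) p e with to (∨⇔ {p k}) e
  ... | inj₁ q = k , ≤-refl , q
  ... | inj₂ q with fwd k p q
  ... | i , i< , r = i , m≤n⇒m≤1+n i< , r
  bwd : ∀ k (p : ℕ → Bool) i → i < k → p i ≡ true → anyN k p ≡ true
  bwd (suc k) p i (s≤s i≤k) e with m≤n⇒m<n∨m≡n i≤k
  ... | inj₁ i<k = from (∨⇔ {p k}) (inj₂ (bwd k p i i<k e))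
  ... | inj₂ refl = from (∨⇔ {p k}) (inj₁ e)

firstTrue-holds : ∀ k (p : ℕ → Bool) i → i < k → p i ≡ true → p (firstTrue k p) ≡ true
firstTrue-holds (suc k) p i i< e with dichotomy (p 0)
... | inj₁ q rewrite q = q
firstTrue-holds (suc k) p zero i< e | inj₂ q = contradiction e (false⇒¬true q)
firstTrue-holds (suc k) p (suc i) (s≤s i<) e | inj₂ q rewrite q =
  firstTrue-holds k (p ∘ suc) i i< e

firstTrue-≤ : ∀ k (p : ℕ → Bool) i → p i ≡ true → firstTrue k p ≤ i
firstTrue-≤ zero    p i e = z≤n
firstTrue-≤ (suc k) p i e with dichotomy (p 0)
... | inj₁ q rewrite q = z≤n
firstTrue-≤ (suc k) p zero e | inj₂ q = contradiction e (false⇒¬true q)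
firstTrue-≤ (suc k) p (suc i) e | inj₂ q rewrite q = s≤s (firstTrue-≤ k (p ∘ suc) i e)

-- A failed search returns `k`, so any result below `k` is a witness. A bound on the topmost one of
-- a column is then enough to know that the cell is filled.
firstTrue-bounded : ∀ k (p : ℕ → Bool) → firstTrue k p < k → p (firstTrue k p) ≡ true
firstTrue-bounded (suc k) p l with dichotomy (p 0)
... | inj₁ q rewrite q = q
... | inj₂ q rewrite q = firstTrue-bounded k (p ∘ suc) (≤-pred l)

firstTrue-unique : ∀ k (p : ℕ → Bool) i → i < k → p i ≡ true → (∀ j → j < i → p j ≡ true → ⊥) → firstTrue k p ≡ i
firstTrue-unique k p i i< e f with m≤n⇒m<n∨m≡n (firstTrue-≤ k p i e)
... | inj₁ l = ⊥-elim (f _ l (firstTrue-holds k p i i< e))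
... | inj₂ q = q

lastTrue-holds : ∀ k (p : ℕ → Bool) i → i < k → p i ≡ true → p (lastTrue k p) ≡ true
lastTrue-holds (suc k) p i (s≤s i≤k) e with dichotomy (p k)
... | inj₁ q rewrite q = q
... | inj₂ q rewrite q with m≤n⇒m<n∨m≡n i≤k
... | inj₁ i<k = lastTrue-holds k p i i<k e
... | inj₂ refl = contradiction e (false⇒¬true q)

lastTrue-≥ : ∀ k (p : ℕ → Bool) i → i < k → p i ≡ true → i ≤ lastTrue k p
lastTrue-≥ (suc k) p i (s≤s i≤k) e with dichotomy (p k)
... | inj₁ q rewrite q = i≤k
... | inj₂ q rewrite q with m≤n⇒m<n∨m≡n i≤k
... | inj₁ i<k = lastTrue-≥ k p i i<k e
... | inj₂ refl = contradiction e (false⇒¬true q)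

lastTrue-< : ∀ k (p : ℕ → Bool) → 0 < k → lastTrue k p < k
lastTrue-< (suc k) p _ with p k
... | true = ≤-refl
lastTrue-< (suc zero)    p _ | false = s≤s z≤n
lastTrue-< (suc (suc k)) p _ | false = m≤n⇒m≤1+n (lastTrue-< (suc k) p z<s)

lastTrue-unique : ∀ k (p : ℕ → Bool) i → i < k → p i ≡ true → (∀ j → i < j → j < k → p j ≡ true → ⊥) → lastTrue k p ≡ i
lastTrue-unique k p i i< e f with m≤n⇒m<n∨m≡n (lastTrue-≥ k p i i< e)
... | inj₁ l = ⊥-elim (f _ l (lastTrue-< k p (≤-trans z<s i<)) (lastTrue-holds k p i i< e))
... | inj₂ q = sym q

-- Counting and permutations

countN-remove : ∀ l (q : ℕ → Bool) x → x < l → q x ≡ true → suc (countN l (λ y → q y ∧ not (y ≡ᵇ x))) ≤ countN l q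
countN-remove (suc l) q x (s≤s x≤l) e with m≤n⇒m<n∨m≡n x≤l
... | inj₂ refl rewrite e | to (T-≡ {x ≡ᵇ x}) (≡⇒≡ᵇ x x refl) = s≤s (weaken x)
  where
  weaken : ∀ l → countN l (λ y → q y ∧ not (y ≡ᵇ x)) ≤ countN l q
  weaken zero    = z≤n
  weaken (suc l) with q l | not (l ≡ᵇ x)
  ... | true  | true  = s≤s (weaken l)
  ... | true  | false = m≤n⇒m≤1+n (weaken l)
  ... | false | _     = weaken l
... | inj₁ x<l rewrite ¬true⇒false (λ p → <⇒≢ x<l (sym (to (≡ᵇ⇔ {l} {x}) p))) with q l
... | true  = s≤s (countN-remove l q x x<l e)
... | false = countN-remove l q x x<l e

-- Induction on `k` deletes `s k` from `q`: injectivity keeps the earlier values away from it, and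
-- `countN-remove` accounts for the deleted element.
countN-inj : ∀ k l (p q : ℕ → Bool) (s : ℕ → ℕ)
  → (∀ i → i < k → p i ≡ true → s i < l × q (s i) ≡ true)
  → (∀ i i' → i < k → i' < k → s i ≡ s i' → i ≡ i')
  → countN k p ≤ countN l q
countN-inj zero    l p q s f g = z≤n
countN-inj (suc k) l p q s f g with dichotomy (p k)
... | inj₂ e rewrite e = countN-inj k l p q s (λ i i< → f i (m≤n⇒m≤1+n i<))
                          (λ i i' a b → g i i' (m≤n⇒m≤1+n a) (m≤n⇒m≤1+n b))
... | inj₁ e rewrite e with f k ≤-refl e
... | sk< , qk = ≤-trans (s≤s (countN-inj k l p (λ y → q y ∧ not (y ≡ᵇ s k)) s
        (λ i i< pi → proj₁ (f i (m≤n⇒m≤1+n i<) pi) ,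
           from ∧⇔ (proj₂ (f i (m≤n⇒m≤1+n i<) pi) ,
             from not⇔ (¬true⇒false λ t →
               <⇒≢ i< (g i k (m≤n⇒m≤1+n i<) ≤-refl (to ≡ᵇ⇔ t)))))
        (λ i i' a b → g i i' (m≤n⇒m≤1+n a) (m≤n⇒m≤1+n b))))
      (countN-remove l q (s k) sk< qk)

countN-mono : ∀ k (p q : ℕ → Bool) → (∀ i → i < k → p i ≡ true → q i ≡ true) → countN k p ≤ countN k q
countN-mono k p q f = countN-inj k k p q id (λ i i< e → i< , f i i< e) (λ _ _ _ _ e → e)

countN-ext : ∀ k (p q : ℕ → Bool) → (∀ i → i < k → p i ≡ true ⇔ q i ≡ true) → countN k p ≡ countN k q
countN-ext k p q f = ≤-antisym (countN-mono k p q (λ i i< → to (f i i<))) (countN-mono k q p (λ i i< → from (f i i<)))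

countN-strict : ∀ k (p q : ℕ → Bool) j → (∀ i → i < k → p i ≡ true → q i ≡ true)
  → j < k → q j ≡ true → p j ≡ false → countN k p < countN k q
countN-strict k p q j f j< qj pj = ≤-trans (s≤s (countN-mono k p _ λ i i< pi →
    from ∧⇔ (f i i< pi , from not⇔ (¬true⇒false λ t → false⇒¬true pj (subst (λ z → p z ≡ true) (to ≡ᵇ⇔ t) pi)))))
  (countN-remove k q j j< qj)

countN-all : ∀ k (p : ℕ → Bool) → (∀ i → i < k → p i ≡ true) → countN k p ≡ k
countN-all zero    p f = refl
countN-all (suc k) p f rewrite f k ≤-refl = cong suc (countN-all k p (λ i i< → f i (m≤n⇒m≤1+n i<)))

countN-none : ∀ k (p : ℕ → Bool) → (∀ i → i < k → p i ≡ true → ⊥) → countN k p ≡ 0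
countN-none zero    p f = refl
countN-none (suc k) p f rewrite ¬true⇒false (f k ≤-refl) = countN-none k p (λ i i< → f i (m≤n⇒m≤1+n i<))

countN-≤ : ∀ k (p : ℕ → Bool) → countN k p ≤ k
countN-≤ k p = ≤-trans (countN-mono k p (λ _ → true) (λ _ _ _ → refl)) (≤-reflexive (countN-all k _ (λ _ _ → refl)))

countN-pos : ∀ k (p : ℕ → Bool) i → i < k → p i ≡ true → 0 < countN k p
countN-pos k p i i< e = ≤-trans (s≤s z≤n) (countN-strict k (λ _ → false) p i (λ _ _ ()) i< e refl)

countN-witness : ∀ k (p q : ℕ → Bool) → countN k p < countN k q → ∃ λ i → i < k × q i ≡ true × p i ≡ false
countN-witness (suc k) p q l with dichotomy (q k) | dichotomy (p k)
... | inj₁ a | inj₂ b = k , ≤-refl , a , b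
... | inj₁ a | inj₁ b rewrite a | b with countN-witness k p q (≤-pred l)
... | i , i< , r = i , m≤n⇒m≤1+n i< , r
countN-witness (suc k) p q l | inj₂ a | inj₁ b rewrite a | b with countN-witness k p q (<⇒≤ l)
... | i , i< , r = i , m≤n⇒m≤1+n i< , r
countN-witness (suc k) p q l | inj₂ a | inj₂ b rewrite a | b with countN-witness k p q l
... | i , i< , r = i , m≤n⇒m≤1+n i< , r

countN-split : ∀ k (p q : ℕ → Bool) → countN k (λ i → p i ∧ q i) + countN k (λ i → p i ∧ not (q i)) ≡ countN k p
countN-split zero    p q = refl
countN-split (suc k) p q with p k | q k
... | true  | true  = cong suc (countN-split k p q)
... | true  | false = trans (+-suc _ _) (cong suc (countN-split k p q))
... | false | _     = countN-split k p q

below-suc : ∀ {k} (Q : ℕ → Set) → (∀ x → x < k → Q x) → Q k → ∀ x → x < suc k → Q x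
below-suc Q q qk x (s≤s x≤k) with m≤n⇒m<n∨m≡n x≤k
... | inj₁ x<k  = q x x<k
... | inj₂ refl = qk

argmax : ∀ k (p : ℕ → Bool) (f : ℕ → ℕ)
  → (∀ x → x < k → p x ≡ true → ⊥) ⊎ (∃ λ x → x < k × p x ≡ true × (∀ y → y < k → p y ≡ true → f y ≤ f x))
argmax zero    p f = inj₁ λ _ ()
argmax (suc k) p f with dichotomy (p k) | argmax k p f
... | inj₂ e | inj₁ none = inj₁ (below-suc _ none (false⇒¬true e))
... | inj₁ e | inj₁ none = inj₂ (k , ≤-refl , e , below-suc _ (λ y y< py → ⊥-elim (none y y< py)) (λ _ → ≤-refl))
... | inj₂ e | inj₂ (x , x< , px , mx) = inj₂ (x , m≤n⇒m≤1+n x< , px , below-suc _ mx (λ py → ⊥-elim (false⇒¬true e py)))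
... | inj₁ e | inj₂ (x , x< , px , mx) with ≤-total (f k) (f x)
... | inj₁ l = inj₂ (x , m≤n⇒m≤1+n x< , px , below-suc _ mx (λ _ → l))
... | inj₂ l = inj₂ (k , ≤-refl , e , below-suc _ (λ y y< py → ≤-trans (mx y y< py) l) (λ _ → ≤-refl))

vget-tabulate : ∀ {A : Set} (d : A) {k} (f : ℕ → A) i → i < k → vget d (tabulate {n = k} (f ∘ toℕ)) i ≡ f i
vget-tabulate d {suc k} f zero    _        = refl
vget-tabulate d {suc k} f (suc i) (s≤s i<) = vget-tabulate d (f ∘ suc) i i<

vget-ext : ∀ {A : Set} (d : A) {k} (v w : Vec A k) → (∀ i → i < k → vget d v i ≡ vget d w i) → v ≡ w
vget-ext d []       []       f = refl
vget-ext d (x ∷ v) (y ∷ w) f = cong₂ _∷_ (f 0 z<s) (vget-ext d v w (λ i i< → f (suc i) (s≤s i<)))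

ent-mkMat : ∀ {m n} (f : ℕ → ℕ → Bool) i j → i < m → j < n → ent (mkMat {m} {n} f) i j ≡ f i j
ent-mkMat {m} {n} f i j i< j< =
  trans (cong (λ v → vget false v j) (vget-tabulate (replicate n false) (λ i → tabulate (λ j → f i (toℕ j))) i i<))
        (vget-tabulate false (f i) j j<)

ent-ext : ∀ {m n} (P Q : Mat m n) → (∀ i j → i < m → j < n → ent P i j ≡ ent Q i j) → P ≡ Q
ent-ext {m} {n} P Q f = vget-ext _ P Q λ i i< → vget-ext false _ _ λ j j< → f i j i< j<

record Perm (k : ℕ) (s t : ℕ → ℕ) : Set where
  field
    s< : ∀ {i} → i < k → s i < k
    t< : ∀ {x} → x < k → t x < k
    ts : ∀ {i} → i < k → t (s i) ≡ i
    st : ∀ {x} → x < k → s (t x) ≡ x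

  s-inj : ∀ i i' → i < k → i' < k → s i ≡ s i' → i ≡ i'
  s-inj i i' i< i'< e = trans (sym (ts i<)) (trans (cong t e) (ts i'<))

  t-inj : ∀ x x' → x < k → x' < k → t x ≡ t x' → x ≡ x'
  t-inj x x' x< x'< e = trans (sym (st x<)) (trans (cong s e) (st x'<))

  -- Counting in both directions: `s` embeds the first `i + 1` positions into `p`, and if `p` fails
  -- at position `i` then `t` sends all of `p` below `i`. This is the step by which sorted
  -- arrangements turn into numbers: Ferrers shapes, burnt sets and ranks all come from it.
  down-count : ∀ (p : ℕ → Bool) → (∀ i i' → i' ≤ i → i < k → p (s i) ≡ true → p (s i') ≡ true)
    → ∀ i → i < k → p (s i) ≡ true ⇔ i < countN k p
  down-count p down i i< = mk⇔ fwd bwd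
    where
    fwd : p (s i) ≡ true → i < countN k p
    fwd e = ≤-trans (≤-reflexive (sym (countN-all (suc i) (λ _ → true) (λ _ _ → refl))))
      (countN-inj (suc i) k (λ _ → true) p s
        (λ i' i'< _ → s< (≤-trans i'< i<) , down i i' (≤-pred i'<) i< e)
        (λ a b a< b< → s-inj a b (≤-trans a< i<) (≤-trans b< i<)))
    bwd : i < countN k p → p (s i) ≡ true
    bwd l with dichotomy (p (s i))
    ... | inj₁ e = e
    ... | inj₂ e = ⊥-elim (<⇒≱ l (≤-trans
        (countN-inj k i p (λ _ → true) t
          (λ x x< px → ≰⇒> (λ i≤tx → false⇒¬true e
              (down (t x) i i≤tx (t< x<) (subst (λ z → p z ≡ true) (sym (st x<)) px))) , refl)
          t-inj)
        (countN-≤ i (λ _ → true))))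

-- If `x` were missed, `f` would inject `k` elements into the numbers below `k` other than `x`.
pigeonhole : ∀ k (f : ℕ → ℕ) → (∀ i → i < k → f i < k) → (∀ i i' → i < k → i' < k → f i ≡ f i' → i ≡ i')
  → ∀ x → x < k → ∃ λ i → i < k × f i ≡ x
pigeonhole k f f< inj x x< with dichotomy (anyN k (λ i → f i ≡ᵇ x))
... | inj₁ e with to (anyN⇔ {k}) e
... | i , i< , q = i , i< , to ≡ᵇ⇔ q
pigeonhole k f f< inj x x< | inj₂ e = ⊥-elim (<⇒≱
  (countN-strict k (λ y → not (y ≡ᵇ x)) (λ _ → true) x (λ _ _ _ → refl) x< refl
     (¬true⇒false (λ q → false⇒¬true (to not⇔ q) (from (≡ᵇ⇔ {x}) refl))))
  (countN-inj k k (λ _ → true) _ f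
     (λ i i< _ → f< i i< , from not⇔ (¬true⇒false (λ q → false⇒¬true e (from (anyN⇔ {k}) (i , i< , q)))))
     inj))

-- The inverse is only asked to work at attained `x`, which is what a search by `firstTrue` can
-- guarantee; `pigeonhole` then makes every `x` attained.
inverse-perm : ∀ k (s t : ℕ → ℕ) → (∀ i → i < k → s i < k)
  → (∀ i i' → i < k → i' < k → s i ≡ s i' → i ≡ i')
  → (∀ x → x < k → (∃ λ i → i < k × s i ≡ x) → t x < k × s (t x) ≡ x)
  → Perm k s t
inverse-perm k s t s< inj inv = record
  { s< = s< _
  ; t< = λ x< → proj₁ (inv' x<)
  ; ts = λ i< → inj _ _ (proj₁ (inv' (s< _ i<))) i< (proj₂ (inv' (s< _ i<)))
  ; st = λ x< → proj₂ (inv' x<)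
  }
  where
  inv' : ∀ {x} → x < k → t x < k × s (t x) ≡ x
  inv' x< = inv _ x< (pigeonhole k s s< inj _ x<)

swap-perm : ∀ {k s t} → Perm k s t → Perm k t s
swap-perm π = record { s< = t< ; t< = s< ; ts = st ; st = ts }
  where open Perm π

firstTrue-inv : ∀ k (f : ℕ → ℕ) x → (∃ λ i → i < k × f i ≡ x)
  → firstTrue k (λ i → f i ≡ᵇ x) < k × f (firstTrue k (λ i → f i ≡ᵇ x)) ≡ x
firstTrue-inv k f x (i , i< , e) =
    ≤-<-trans (firstTrue-≤ k _ i (from ≡ᵇ⇔ e)) i<
  , to ≡ᵇ⇔ (firstTrue-holds k _ i i< (from ≡ᵇ⇔ e))

label : ∀ {k} → ℕ → Vec ℕ k → ℕ → ℕ
label base v i = vat v i ∸ base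

-- Written as the same search as in `surp`, so that `rowOf` and `colOf` agree with it by
-- computation, at base `0` and base `m`.
place : ∀ {k} → ℕ → Vec ℕ k → ℕ → ℕ
place {k} base v x = firstTrue k (λ r → vat v r ≡ᵇ base + x)

module _ {k : ℕ} (base : ℕ) (v : Vec ℕ k) (pv : IsPermFrom base v) where

  vat-label : ∀ i → i < k → vat v i ≡ base + label base v i
  vat-label i i< = sym (m+[n∸m]≡n (proj₁ (proj₁ pv i i<)))

  perm-of : Perm k (label base v) (place base v)
  perm-of = inverse-perm k _ _
    (λ i i< → +-cancelˡ-< base _ _ (subst (_< base + k) (vat-label i i<) (proj₂ (proj₁ pv i i<))))
    (λ i i' i< i'< e → proj₂ pv i i' i< i'< (trans (vat-label i i<) (trans (cong (base +_) e) (sym (vat-label i' i'<)))))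
    (λ x x< (i , i< , e) →
      let a , b = firstTrue-inv k (vat v) (base + x) (i , i< , trans (vat-label i i<) (cong (base +_) e))
      in a , trans (cong (_∸ base) b) (m+n∸m≡n base x))

-- Sorting with ties broken by label

Lex : (ℕ → ℕ) → ℕ → ℕ → Set
Lex K x y = K x < K y ⊎ (K x ≡ K y × x < y)

lexᵇ : (ℕ → ℕ) → ℕ → ℕ → Bool
lexᵇ K x y = (K x <ᵇ K y) ∨ ((K x ≡ᵇ K y) ∧ (x <ᵇ y))

lex⇔ : ∀ {K x y} → lexᵇ K x y ≡ true ⇔ Lex K x y
lex⇔ {K} {x} {y} = mk⇔ fwd bwd
  where
  fwd : lexᵇ K x y ≡ true → Lex K x y
  fwd e with to (∨⇔ {K x <ᵇ K y}) e
  ... | inj₁ a = inj₁ (to <ᵇ⇔ a)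
  ... | inj₂ b = inj₂ (to ≡ᵇ⇔ (proj₁ (to ∧⇔ b)) , to <ᵇ⇔ (proj₂ (to (∧⇔ {K x ≡ᵇ K y}) b)))
  bwd : Lex K x y → lexᵇ K x y ≡ true
  bwd (inj₁ a) = from (∨⇔ {K x <ᵇ K y}) (inj₁ (from <ᵇ⇔ a))
  bwd (inj₂ (a , b)) = from (∨⇔ {K x <ᵇ K y}) (inj₂ (from ∧⇔ (from ≡ᵇ⇔ a , from <ᵇ⇔ b)))

module LexOrder (K : ℕ → ℕ) where

  lex-trans : ∀ {x y z} → Lex K x y → Lex K y z → Lex K x z
  lex-trans (inj₁ a) (inj₁ b) = inj₁ (<-trans a b)
  lex-trans (inj₁ a) (inj₂ (e , _)) = inj₁ (<-≤-trans a (≤-reflexive e))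
  lex-trans (inj₂ (e , _)) (inj₁ b) = inj₁ (≤-<-trans (≤-reflexive e) b)
  lex-trans (inj₂ (e , a)) (inj₂ (e' , b)) = inj₂ (trans e e' , <-trans a b)

  lex-irrefl : ∀ {x} → ¬ Lex K x x
  lex-irrefl (inj₁ a) = <-irrefl refl a
  lex-irrefl (inj₂ (_ , a)) = <-irrefl refl a

  lex-total : ∀ x y → x ≢ y → Lex K x y ⊎ Lex K y x
  lex-total x y ne with <-cmp (K x) (K y)
  ... | tri< a _ _ = inj₁ (inj₁ a)
  ... | tri> _ _ b = inj₂ (inj₁ b)
  ... | tri≈ _ e _ with <-cmp x y
  ... | tri< a _ _ = inj₁ (inj₂ (e , a))
  ... | tri≈ _ q _ = ⊥-elim (ne q)
  ... | tri> _ _ b = inj₂ (inj₂ (sym e , b))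

  lex⇒≤ : ∀ {x y} → Lex K x y → K x ≤ K y
  lex⇒≤ (inj₁ a) = <⇒≤ a
  lex⇒≤ (inj₂ (e , _)) = ≤-reflexive e

LexSorted : ∀ {k} → ℕ → (ℕ → ℕ) → Vec ℕ k → Set
LexSorted {k} base K v = ∀ i i' → i < i' → i' < k → Lex K (label base v i) (label base v i')

module Sort (k : ℕ) (K : ℕ → ℕ) where

  open LexOrder K

  pos srt : ℕ → ℕ
  pos x = countN k (λ y → lexᵇ K y x)
  srt i = firstTrue k (λ x → pos x ≡ᵇ i)

  pos-mono : ∀ {x y} → x < k → Lex K x y → pos x < pos y
  pos-mono {x} {y} x< l = countN-strict k _ _ x
    (λ z _ e → from (lex⇔ {K} {z}) (lex-trans (to (lex⇔ {K} {z}) e) l)) x< (from (lex⇔ {K} {x}) l)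
    (¬true⇒false (λ e → lex-irrefl (to (lex⇔ {K} {x} {x}) e)))

  pos< : ∀ x → x < k → pos x < k
  pos< x x< = ≤-trans (countN-strict k _ (λ _ → true) x (λ _ _ _ → refl) x< refl
    (¬true⇒false (λ e → lex-irrefl (to (lex⇔ {K} {x} {x}) e)))) (countN-≤ k (λ _ → true))

  pos-inj : ∀ x y → x < k → y < k → pos x ≡ pos y → x ≡ y
  pos-inj x y x< y< e with x ≟ y
  ... | yes q = q
  ... | no ne with lex-total x y ne
  ... | inj₁ l = ⊥-elim (<⇒≢ (pos-mono x< l) e)
  ... | inj₂ l = ⊥-elim (<⇒≢ (pos-mono y< l) (sym e))

  srt-perm : Perm k srt pos
  srt-perm = swap-perm (inverse-perm k pos srt pos< pos-inj (λ i i< → firstTrue-inv k pos i))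

  open Perm srt-perm

  srt-lex : ∀ i i' → i < i' → i' < k → Lex K (srt i) (srt i')
  srt-lex i i' l i'< with lex-total (srt i) (srt i') (λ e → <⇒≢ l (s-inj i i' (<-trans l i'<) i'< e))
  ... | inj₁ r = r
  ... | inj₂ r = ⊥-elim (<-asym l (subst₂ _<_ (ts i'<) (ts (<-trans l i'<)) (pos-mono (s< i'<) r)))

  vec : ℕ → Vec ℕ k
  vec base = tabulate (λ i → base + srt (toℕ i))

  vat-vec : ∀ base i → i < k → vat (vec base) i ≡ base + srt i
  vat-vec base i i< = vget-tabulate 0 (λ i → base + srt i) i i<

  vec-perm : ∀ base → IsPermFrom base (vec base)
  vec-perm base =
      (λ i i< → subst (base ≤_) (sym (vat-vec base i i<)) (m≤m+n base _)
              , subst (_< base + k) (sym (vat-vec base i i<)) (+-monoʳ-< base (s< i<)))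
    , (λ i i' i< i'< e → s-inj i i' i< i'<
         (+-cancelˡ-≡ base _ _ (trans (sym (vat-vec base i i<)) (trans e (vat-vec base i' i'<)))))

  label-vec : ∀ base i → i < k → label base (vec base) i ≡ srt i
  label-vec base i i< = trans (cong (_∸ base) (vat-vec base i i<)) (m+n∸m≡n base _)

  vec-lex : ∀ base → LexSorted base K (vec base)
  vec-lex base i i' l i'< = subst₂ (Lex K) (sym (label-vec base i (<-trans l i'<))) (sym (label-vec base i' i'<)) (srt-lex i i' l i'<)

  -- In a sorted arrangement the elements below the one in position `i` are those in earlier
  -- positions, so its rank `pos` is `i`, and the rank determines the element.
  vec-unique : ∀ base (v : Vec ℕ k) → IsPermFrom base v
    → LexSorted base K v → v ≡ vec base
  vec-unique base v pv lx = vget-ext 0 v (vec base) λ i i< →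
      trans (vat-label base v pv i i<) (trans (cong (base +_) (same i i<)) (sym (vat-vec base i i<)))
    where
    module V = Perm (perm-of base v pv)
    s : ℕ → ℕ
    s = label base v
    below : ∀ i j → i < k → j < k → lexᵇ K (s j) (s i) ≡ true ⇔ j < i
    below i j i< j< = mk⇔ fwd (λ l → from (lex⇔ {K} {s j}) (lx j i l i<))
      where
      fwd : lexᵇ K (s j) (s i) ≡ true → j < i
      fwd e with <-cmp j i
      ... | tri< a _ _ = a
      ... | tri≈ _ refl _ = ⊥-elim (lex-irrefl (to (lex⇔ {K} {s j} {s j}) e))
      ... | tri> _ _ b = ⊥-elim (lex-irrefl (lex-trans (lx i j b j<) (to (lex⇔ {K} {s j} {s i}) e)))
    count : ∀ i → i < k → ∀ j → j < k → lexᵇ K (s j) (s i) ≡ true ⇔ j < pos (s i)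
    count i i< = V.down-count (λ y → lexᵇ K y (s i)) λ j j' l j< e →
      from (below i j' i< (≤-<-trans l j<)) (≤-<-trans l (to (below i j i< j<) e))
    pos-s : ∀ i → i < k → pos (s i) ≡ i
    pos-s i i< with <-cmp (pos (s i)) i
    ... | tri≈ _ e _ = e
    ... | tri< a _ _ = ⊥-elim (<-irrefl refl (to (count i i< _ (<-trans a i<)) (from (below i _ i< (<-trans a i<)) a)))
    ... | tri> _ _ b = ⊥-elim (<-irrefl refl (to (below i i i< i<) (from (count i i< i i<) b)))
    same : ∀ i → i < k → s i ≡ srt i
    same i i< = trans (sym (st (V.s< i<))) (cong srt (pos-s i i<))

Monotone : ℕ → (ℕ → ℕ) → Set
Monotone k f = ∀ {i i'} → i ≤ i' → i' < k → f i ≤ f i'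

lex-monotone : ∀ {k} K {s : ℕ → ℕ} → (∀ i i' → i < i' → i' < k → Lex K (s i) (s i')) → Monotone k (K ∘ s)
lex-monotone K lx {i} {i'} l i'< with m≤n⇒m<n∨m≡n l
... | inj₁ l' = LexOrder.lex⇒≤ K (lx i i' l' i'<)
... | inj₂ refl = ≤-refl

-- The elements with `K x ≤ K (s i)` fill an initial segment of either arrangement, and the two
-- segments have the same length. It lets the rows of `D`, sorted by start, and those of φ(T),
-- sorted by size, share one Ferrers shape.
rearrangement : ∀ {k K s t s' t'} → Perm k s t → Perm k s' t' → Monotone k (K ∘ s) → Monotone k (K ∘ s')
  → ∀ i → i < k → K (s i) ≡ K (s' i)
rearrangement {k} {K} π π' m m' i i< = ≤-antisym (half π' π m' m) (half π π' m m')
  where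
  half : ∀ {s t s' t'} → Perm k s t → Perm k s' t' → Monotone k (K ∘ s) → Monotone k (K ∘ s') → K (s' i) ≤ K (s i)
  half {s} {_} {s'} π π' m m' = to ≤ᵇ⇔ (from (Perm.down-count π' p (down m') i i<)
                           (to (Perm.down-count π p (down m) i i<) (from (≤ᵇ⇔ {K (s i)}) ≤-refl)))
    where
    p : ℕ → Bool
    p x = K x ≤ᵇ K (s i)
    down : ∀ {σ : ℕ → ℕ} → Monotone k (K ∘ σ) → ∀ j j' → j' ≤ j → j < k → p (σ j) ≡ true → p (σ j') ≡ true
    down m j j' l j< e = from ≤ᵇ⇔ (≤-trans (m l j<) (to ≤ᵇ⇔ e))

-- EW-tableaux

supports : (k l : ℕ) → (ℕ → ℕ → Bool) → ℕ → ℕ → Set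
supports k l A x y = ∃ λ x' → ∃ λ y' → x' < k × y' < l × A x' y' ≡ false × A x' y ≡ true × A x y' ≡ true

-- Rows and columns of an EW-tableau are treated alike: the ones of A are the zeros of
-- the tableau when the lines are its rows, and its ones when the lines are its columns.
-- The nonzero values of smaller are attained as sizes: smaller x is the next size below size x.
module Lines (k l : ℕ) (A cs : ℕ → ℕ → Bool)
  (nested : ∀ {x x' y y'} → x < k → x' < k → y < l → y' < l
     → A x y ≡ true → A x' y ≡ false → A x' y' ≡ true → A x y' ≡ true)
  (cs⇔ : ∀ {x y} → x < k → y < l → A x y ≡ true → cs x y ≡ true ⇔ supports k l A x y) where

  size smaller : ℕ → ℕ
  size x    = countN l (λ y → A x y)
  smaller x = countN l (λ y → A x y ∧ cs x y)

  size-< : ∀ {x x' y} → x < k → x' < k → y < l → A x y ≡ true → A x' y ≡ false → size x' < size x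
  size-< {x} {x'} {y} x< x'< y< e f = countN-strict l (A x') (A x) y (λ y' y'< → nested x< x'< y< y'< e f) y< e f

  size-≤ : ∀ {x x' y} → x < k → x' < k → y < l → size x ≤ size x' → A x y ≡ true → A x' y ≡ true
  size-≤ {x} {x'} {y} x< x'< y< le e with dichotomy (A x' y)
  ... | inj₁ t = t
  ... | inj₂ f = ⊥-elim (<⇒≱ (size-< x< x'< y< e f) le)

  -- A smaller line `x'` is contained in `x`, and a single `y'` of `x` outside `x'` completes a
  -- corner with every one of `x'`, so all of these are cornersupport in `x`.
  size≤smaller : ∀ {x x'} → x < k → x' < k → size x' < size x → size x' ≤ smaller x
  size≤smaller {x} {x'} x< x'< lt with countN-witness l (A x') (A x) lt
  ... | y' , y'< , e , f = countN-mono l (A x') _ λ y y< a →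
        let b = size-≤ x'< x< y< (<⇒≤ lt) a
        in from ∧⇔ (b , from (cs⇔ x< y< b) (x' , y' , x'< , y'< , f , a , e))

  -- Each cornersupport one of `x` lies in some strictly smaller line, hence by nestedness in the
  -- largest such line `w`; without a smaller line there are none. The bound `b` is left open so
  -- that a prescribed start can take its place.
  smaller≤ : ∀ {x b} → x < k → (∀ {x'} → x' < k → size x' < size x → size x' ≤ b) → smaller x ≤ b
  smaller≤ {x} {b} x< bound with argmax k (λ x' → size x' <ᵇ size x) size
  ... | inj₁ none = ≤-trans (≤-reflexive (countN-none l _ absurd)) z≤n
    where
    absurd : ∀ y → y < l → A x y ∧ cs x y ≡ true → ⊥
    absurd y y< e with to (∧⇔ {A x y}) e
    ... | a , c with to (cs⇔ x< y< a) c
    ... | x' , y' , x'< , y'< , f , a' , e' = none x' x'< (from <ᵇ⇔ (size-< x< x'< y'< e' f))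
  ... | inj₂ (w , w< , lt , greatest) = ≤-trans (countN-mono l _ (A w) cover) (bound w< (to <ᵇ⇔ lt))
    where
    cover : ∀ y → y < l → A x y ∧ cs x y ≡ true → A w y ≡ true
    cover y y< e with to (∧⇔ {A x y}) e
    ... | a , c with to (cs⇔ x< y< a) c
    ... | x' , y' , x'< , y'< , f , a' , e' = size-≤ x'< w< y< (greatest x' x'< (from <ᵇ⇔ (size-< x< x'< y'< e' f))) a'

module _ {m n : ℕ} (T : Mat m n) {j k : ℕ} {b : Bool} (Tjk : ent T j k ≡ b) where

  cornersupport⇔ : cornersupport T j k ≡ true ⇔
    (∃ λ j' → ∃ λ k' → j' < m × k' < n × ent T j' k' ≡ not b × ent T j' k ≡ b × ent T j k' ≡ b)
  cornersupport⇔ rewrite Tjk = mk⇔ fwd bwd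
    where
    fwd : _ → _
    fwd e with to (anyN⇔ {m}) e
    ... | j' , j'< , e₁ with to (anyN⇔ {n}) e₁
    ... | k' , k'< , e₂ =
      let _ , e₃ = to (∧⇔ {not (j' ≡ᵇ j)}) e₂
          _ , e₄ = to (∧⇔ {not (k' ≡ᵇ k)}) e₃
          a , e₅ = to (∧⇔ {beq (ent T j' k') (not b)}) e₄
          c , d = to (∧⇔ {beq (ent T j' k) b}) e₅
      in j' , k' , j'< , k'< , to beq⇔ a , to beq⇔ c , to beq⇔ d
    b≢not : ∀ {b} → b ≢ not b
    b≢not {true} ()
    b≢not {false} ()
    bwd : _ → _
    -- The inequalities between indices come from the entries: with equal rows the entry at `k'`, or
    -- with equal columns the entry at `j'`, would be both `b` and `not b`.
    bwd (j' , k' , j'< , k'< , a , c , d) = from (anyN⇔ {m}) (j' , j'< , from (anyN⇔ {n}) (k' , k'< ,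
      from ∧⇔ (from not⇔ (¬true⇒false λ q → b≢not (trans (sym d) (trans (cong (λ z → ent T z k') (sym (to (≡ᵇ⇔ {j'}) q))) a))) ,
      from ∧⇔ (from not⇔ (¬true⇒false λ q → b≢not (trans (sym c) (trans (cong (λ z → ent T j' z) (sym (to (≡ᵇ⇔ {k'}) q))) a))) ,
      from ∧⇔ (from beq⇔ a , from ∧⇔ (from beq⇔ c , from beq⇔ d))))))

module EW {m n : ℕ} (T : Mat m n) (ew : IsEW T) where

  no-corner : ∀ {i i' k k'} → i < m → i' < m → k < n → k' < n
    → ent T i k ≡ false → ent T i' k' ≡ false → ent T i k' ≡ true → ent T i' k ≡ true → ⊥
  no-corner {i} {i'} {k} {k'} i< i'< k< k'< a b c d = proj₂ (proj₂ ew) i i' k k' i< i'< k< k'<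
    (λ { refl → false⇒¬true a d }) (λ { refl → false⇒¬true a c }) a b c d

  private
    not-true : ∀ {b} → not b ≡ false → b ≡ true
    not-true {true} _ = refl

  row-nested : ∀ {x x' y y'} → x < m → x' < m → y < n → y' < n
    → not (ent T x y) ≡ true → not (ent T x' y) ≡ false → not (ent T x' y') ≡ true → not (ent T x y') ≡ true
  row-nested {x} {x'} {y} {y'} x< x'< y< y'< a b c with dichotomy (ent T x y')
  ... | inj₂ e = from not⇔ e
  ... | inj₁ e = ⊥-elim (no-corner x< x'< y< y'< (to not⇔ a) (to not⇔ c) e (not-true b))

  row-cs⇔ : ∀ {x y} → x < m → y < n → not (ent T x y) ≡ true
    → cornersupport T x y ≡ true ⇔ supports m n (λ x y → not (ent T x y)) x y
  row-cs⇔ x< y< a = mk⇔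
    (λ e → let x' , y' , x'< , y'< , p , q , r = to (cornersupport⇔ T (to not⇔ a)) e
           in x' , y' , x'< , y'< , cong not p , cong not q , cong not r)
    (λ { (x' , y' , x'< , y'< , p , q , r) →
       from (cornersupport⇔ T (to not⇔ a)) (x' , y' , x'< , y'< , not-true p , to not⇔ q , to not⇔ r) })

  col-nested : ∀ {y y' x x'} → y < n → y' < n → x < m → x' < m
    → ent T x y ≡ true → ent T x y' ≡ false → ent T x' y' ≡ true → ent T x' y ≡ true
  col-nested {y} {y'} {x} {x'} y< y'< x< x'< a b c with dichotomy (ent T x' y)
  ... | inj₁ e = e
  ... | inj₂ e = ⊥-elim (no-corner x'< x< y< y'< e b c a)

  col-cs⇔ : ∀ {y x} → y < n → x < m → ent T x y ≡ true
    → cornersupport T x y ≡ true ⇔ supports n m (λ y x → ent T x y) y x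
  col-cs⇔ y< x< a = mk⇔
    (λ e → let x' , y' , x'< , y'< , p , q , r = to (cornersupport⇔ T a) e
           in y' , x' , y'< , x'< , p , r , q)
    (λ { (y' , x' , y'< , x'< , p , q , r) → from (cornersupport⇔ T a) (x' , y' , x'< , y'< , p , r , q) })

  module Row = Lines m n (λ x y → not (ent T x y)) (λ x y → cornersupport T x y) row-nested row-cs⇔
  module Col = Lines n m (λ y x → ent T x y) (λ y x → cornersupport T x y) col-nested col-cs⇔

-- Ribbons and bounce paths

-- The sorted tableau T' has zeros in the first z i places of row i
-- and ones in the first h j places of column j.
record Ferrers (m n : ℕ) (z h : ℕ → ℕ) : Set where
  field
    0<m    : 0 < m
    0<n    : 0 < n
    z-zero : z 0 ≡ 0
    z-pos  : ∀ {i} → 1 ≤ i → i < m → 1 ≤ z i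
    z-bound    : ∀ {i} → i < m → z i ≤ n
    h-pos  : ∀ {j} → j < n → 1 ≤ h j
    h-bound    : ∀ {j} → j < n → h j ≤ m
    z-mono : Monotone m z
    h-mono : Monotone n h
    galois : ∀ {i j} → i < m → j < n → j < z i ⇔ h j ≤ i

  -- Row 1, if it exists, has a zero; zeros stand at the left, so the one of column 0 in row 0 is
  -- its only one.
  h-first : h 0 ≡ 1
  h-first = ≤-antisym bound (h-pos 0<n)
    where
    bound : h 0 ≤ 1
    bound with m≤n⇒m<n∨m≡n 0<m
    ... | inj₁ 1<m = to (galois 1<m 0<n) (z-pos ≤-refl 1<m)
    ... | inj₂ refl = h-bound 0<n

  galois′ : ∀ {i j} → i < m → j < n → z i ≤ j ⇔ i < h j
  galois′ i< j< = mk⇔ (λ a → ≰⇒> (λ b → <⇒≱ (from (galois i< j<) b) a))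
                      (λ a → ≮⇒≥ (λ b → <⇒≱ a (to (galois i< j<) b)))

-- The ones of φ(T) are the lowest ones of the columns of T' and the rightmost zeros of its rows.
IsRibbon : ∀ {m n} → Mat m n → (z h : ℕ → ℕ) → Set
IsRibbon {m} {n} R z h = ∀ i j → i < m → j < n → ent R i j ≡ true ⇔ (h j ≡ suc i ⊎ z i ≡ suc j)

module _ {m n : ℕ} {z h : ℕ → ℕ} (F : Ferrers m n z h) where
  open Ferrers F

  -- Left of the rightmost zero of a row everything in the sorted tableau is zero, so no cell there
  -- can be the lowest one of a column.
  ribbon-leftmost : ∀ (R : Mat m n) → IsRibbon R z h → ∀ i → i < m → leftmost R i ≡ z i ∸ 1
  -- Row 0 has no zeros. Its leftmost ribbon cell is the lowest one of column 0, and truncation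
  -- makes `z 0 ∸ 1` agree with it.
  ribbon-leftmost R rib zero i< = trans
    (firstTrue-unique n _ 0 0<n (from (rib 0 0 0<m 0<n) (inj₁ h-first)) (λ _ ()))
    (sym (cong (_∸ 1) z-zero))
  ribbon-leftmost R rib i@(suc _) i< = firstTrue-unique n _ (z i ∸ 1)
    (≤-trans (≤-reflexive 1+z-1) (z-bound i<))
    (from (rib i _ i< (≤-trans (≤-reflexive 1+z-1) (z-bound i<))) (inj₂ (sym 1+z-1)))
    (λ j j< e → absurd j j< (to (rib i j i< (<-trans j< (≤-trans (≤-reflexive 1+z-1) (z-bound i<)))) e))
    where
    1+z-1 : suc (z i ∸ 1) ≡ z i
    1+z-1 = m+[n∸m]≡n (z-pos (s≤s z≤n) i<)
    absurd : ∀ j → j < z i ∸ 1 → h j ≡ suc i ⊎ z i ≡ suc j → ⊥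
    absurd j j< (inj₁ e) = <⇒≱ (≤-reflexive (sym e)) (to (galois i< (<-trans j< (≤-trans (≤-reflexive 1+z-1) (z-bound i<)))) (<-trans j< (≤-reflexive 1+z-1)))
    absurd j j< (inj₂ e) = <⇒≢ j< (sym (cong (_∸ 1) e))

  ribbon-topmost : ∀ (R : Mat m n) → IsRibbon R z h → ∀ j → j < n → topmost R j ≡ h j ∸ 1
  ribbon-topmost R rib j j< = firstTrue-unique m _ (h j ∸ 1)
    h-1<m
    (from (rib _ j h-1<m j<) (inj₁ (sym 1+h-1)))
    (λ i i< e → absurd i i< (to (rib i j (<-trans i< h-1<m) j<) e))
    where
    1+h-1 : suc (h j ∸ 1) ≡ h j
    1+h-1 = m+[n∸m]≡n (h-pos j<)
    h-1<m : h j ∸ 1 < m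
    h-1<m = ≤-trans (≤-reflexive 1+h-1) (h-bound j<)
    absurd : ∀ i → i < h j ∸ 1 → h j ≡ suc i ⊎ z i ≡ suc j → ⊥
    absurd i i< (inj₁ e) = <⇒≢ i< (sym (cong (_∸ 1) e))
    absurd i i< (inj₂ e) = <⇒≱ (<-trans i< (≤-reflexive 1+h-1)) (to (galois (<-trans i< h-1<m) j<) (≤-reflexive (sym e)))

ribbon-unique : ∀ {m n z h} (R R' : Mat m n) → IsRibbon R z h → IsRibbon R' z h → R ≡ R'
ribbon-unique R R' r r' = ent-ext R R' λ i j i< j< → bool-ext (λ e → from (r' i j i< j<) (to (r i j i< j<) e))
                                                        (λ e → from (r i j i< j<) (to (r' i j i< j<) e))

-- The left and the upper boundary suffice: a row ends where the next column starts below it.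
poly : ∀ {m n} → (ℕ → ℕ) → (ℕ → ℕ) → Mat m n
poly lft top = mkMat (λ i j → (lft i ≤ᵇ j) ∧ (top j ≤ᵇ i))

poly⇔ : ∀ {m n} (lft top : ℕ → ℕ) {i j} → i < m → j < n
  → ent (poly {m} {n} lft top) i j ≡ true ⇔ (lft i ≤ j × top j ≤ i)
poly⇔ {m} {n} lft top {i} {j} i< j< = mk⇔
  (λ e → let a , b = to (∧⇔ {lft i ≤ᵇ j}) (trans (sym ent≡) e) in to ≤ᵇ⇔ a , to ≤ᵇ⇔ b)
  (λ (a , b) → trans ent≡ (from ∧⇔ (from ≤ᵇ⇔ a , from ≤ᵇ⇔ b)))
  where
  ent≡ : ent (poly {m} {n} lft top) i j ≡ (lft i ≤ᵇ j) ∧ (top j ≤ᵇ i)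
  ent≡ = ent-mkMat (λ i j → (lft i ≤ᵇ j) ∧ (top j ≤ᵇ i)) i j i< j<

-- In each row i ≥ 1 the surplus z i ∸ 1 ∸ lft i ranges over the gap between z i
-- and the next smaller value of z (z 0 = 0 is such a value); similarly for the columns,
-- where 0 bounds the lowest gap.
record Fits (m n : ℕ) (z h lft top : ℕ → ℕ) : Set where
  field
    lft-zero : lft 0 ≡ 0
    lft<z    : ∀ {i} → 1 ≤ i → i < m → lft i < z i
    z≤lft    : ∀ {i i'} → 1 ≤ i → i < m → i' < m → z i' < z i → z i' ≤ lft i
    top<h    : ∀ {j} → j < n → top j < h j
    h≤top    : ∀ {j j'} → j < n → j' < n → h j' < h j → h j' ≤ top j

module Bounce {m n : ℕ} {z h lft top : ℕ → ℕ} (F : Ferrers m n z h) (fits : Fits m n z h lft top) where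
  open Ferrers F
  open Fits fits

  P : Mat m n
  P = poly lft top

  -- The path turns right at (r , C ∸ 1); the truncation is for the start, where C is 0.
  Corner : ℕ → ℕ → Set
  Corner r C = ∀ i → i < m → i ≤ r ⇔ z i ≤ C

  -- One right-then-down move, ending at `(r' , c')`. By `top<h`, columns with at most `r + 1` ones
  -- reach up to row `r`, and `h≤top` excludes the later ones; for the vertical leg `lft<z` and
  -- `z≤lft` play these roles.
  module Step (r C : ℕ) (r< : r < m) (C≤n : C ≤ n) (corner : Corner r C) where

    zr≤C : z r ≤ C
    zr≤C = to (corner r r<) ≤-refl

    next-row : suc r < m → C < z (suc r)
    next-row l = ≰⇒> λ le → <-irrefl refl (from (corner (suc r) l) le)

    C≤⇒h> : ∀ j → j < n → C ≤ j → r < h j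
    C≤⇒h> j j< le = to (galois′ r< j<) (≤-trans zr≤C le)

    r<⇒ : ∀ {i} → i < m → r < i → suc r < m
    r<⇒ i< l = ≤-<-trans l i<

    c' : ℕ
    c' = lastTrue n (λ j → h j ≤ᵇ suc r)

    c'< : c' < n
    c'< = lastTrue-< n _ 0<n

    hc'≤ : h c' ≤ suc r
    hc'≤ = to ≤ᵇ⇔ (lastTrue-holds n (λ j → h j ≤ᵇ suc r) 0 0<n (from ≤ᵇ⇔ (≤-trans (≤-reflexive h-first) (s≤s z≤n))))

    ≤c' : ∀ j → j < n → h j ≤ suc r → j ≤ c'
    ≤c' j j< l = lastTrue-≥ n _ j j< (from ≤ᵇ⇔ l)

    >c' : ∀ j → j < n → c' < j → suc r < h j
    >c' j j< l = ≰⇒> λ le → <⇒≱ l (≤c' j j< le)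

    j<zr⇒≤c' : ∀ j → j < n → j < z r → j ≤ c'
    j<zr⇒≤c' j j< l = ≤c' j j< (m≤n⇒m≤1+n (to (galois r< j<) l))

    zr≤1+c' : z r ≤ suc c'
    zr≤1+c' with z r in eq
    ... | zero = z≤n
    ... | suc q = s≤s (j<zr⇒≤c' q (≤-trans (≤-reflexive (sym eq)) (z-bound r<)) (≤-reflexive (sym eq)))

    lft≤c' : ∀ {i} → i < m → z i ≤ suc c' → lft i ≤ c'
    lft≤c' {zero}  _  _ = ≤-trans (≤-reflexive lft-zero) z≤n
    lft≤c' {suc i} i< l = ≤-pred (≤-trans (lft<z (s≤s z≤n) i<) l)

    rightmost≡ : rightmost P r ≡ c'
    rightmost≡ = lastTrue-unique n _ c' c'<
      (from (poly⇔ lft top r< c'<) (lft≤c' r< zr≤1+c' , ≤-pred (≤-trans (top<h c'<) hc'≤)))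
      λ j l j< e → <⇒≱ (beyond j l j<) (proj₂ (to (poly⇔ lft top r< j<) e))
      where
      beyond : ∀ j → c' < j → j < n → r < top j
      -- Column `C` has exactly `r + 1` ones and column `j` has more, so the gap condition pushes
      -- the start of column `j` below row `r`.
      beyond j l j< = ≤-trans (≤-reflexive (sym hC≡)) (h≤top j< C<n (subst (_< h j) (sym hC≡) (>c' j j< l)))
        where
        1+r<m : suc r < m
        1+r<m = <-≤-trans (>c' j j< l) (h-bound j<)
        C<n : C < n
        C<n = <-≤-trans (next-row 1+r<m) (z-bound 1+r<m)
        hC≡ : h C ≡ suc r
        hC≡ = ≤-antisym (to (galois 1+r<m C<n) (next-row 1+r<m)) (C≤⇒h> C C<n ≤-refl)

    C' : ℕ
    C' = suc c'

    r' : ℕ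
    r' = lastTrue m (λ i → z i ≤ᵇ C')

    r'< : r' < m
    r'< = lastTrue-< m _ 0<m

    zr'≤ : z r' ≤ C'
    zr'≤ = to ≤ᵇ⇔ (lastTrue-holds m (λ i → z i ≤ᵇ C') r r< (from ≤ᵇ⇔ zr≤1+c'))

    r≤r' : r ≤ r'
    r≤r' = lastTrue-≥ m _ r r< (from ≤ᵇ⇔ zr≤1+c')

    corner' : Corner r' C'
    corner' i i< = mk⇔ (λ l → ≤-trans (z-mono l r'<) zr'≤) (λ l → lastTrue-≥ m _ i i< (from ≤ᵇ⇔ l))

    c'<z : ∀ i → i < m → r < i → c' < z i
    c'<z i i< l = from (galois i< c'<) (≤-trans hc'≤ l)

    lowest≡ : lowest P c' ≡ r'
    lowest≡ = lastTrue-unique m _ r' r'<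
      (from (poly⇔ lft top r'< c'<) (lft≤c' r'< zr'≤ , ≤-trans (≤-pred (≤-trans (top<h c'<) hc'≤)) r≤r'))
      λ i l i< e → <⇒≱ (beyond i l i<) (proj₁ (to (poly⇔ lft top i< c'<) e))
      where
      beyond : ∀ i → r' < i → i < m → c' < lft i
      -- Row `r + 1` has exactly `C'` zeros and row `i` has more, so row `i` starts to the right of
      -- `c'`.
      beyond i l i< = ≤-trans (≤-reflexive (sym z≡))
        (z≤lft (≤-trans (s≤s z≤n) l) i< 1+r<m (subst (_< z i) (sym z≡) C'<z))
        where
        1+r<m : suc r < m
        1+r<m = r<⇒ i< (≤-<-trans r≤r' l)
        C'<z : C' < z i
        C'<z = ≰⇒> λ le → <⇒≱ l (from (corner' i i<) le)
        C'<n : C' < n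
        C'<n = <-≤-trans C'<z (z-bound i<)
        z≡ : z (suc r) ≡ C'
        z≡ = ≤-antisym (from (galois′ 1+r<m C'<n) (>c' C' C'<n ≤-refl)) (c'<z (suc r) 1+r<m ≤-refl)

    c≤c' : C ∸ 1 ≤ c'
    c≤c' with m≤n⇒m<n∨m≡n (z≤n {C})
    ... | inj₂ refl = z≤n
    ... | inj₁ 0<C = ≤c' (C ∸ 1) c<n bound
      where
      1+c : suc (C ∸ 1) ≡ C
      1+c = m+[n∸m]≡n 0<C
      c<n : C ∸ 1 < n
      c<n = ≤-trans (≤-reflexive 1+c) C≤n
      bound : h (C ∸ 1) ≤ suc r
      bound with m≤n⇒m<n∨m≡n r<
      ... | inj₁ 1+r<m = to (galois 1+r<m c<n) (<-trans (≤-reflexive 1+c) (next-row 1+r<m))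
      ... | inj₂ refl = h-bound c<n

    C≤C' : C ≤ C'
    C≤C' = ≤-trans (m≤n+m∸n C 1) (s≤s c≤c')

    -- Column `C` has at most `r + 1` ones, because row `r + 1`, if there is one, has more than `C`
    -- zeros; the horizontal leg therefore covers it. This is what lets the fuel of the walk be
    -- measured in columns.
    progress : C < n → C < C'
    progress l with m≤n⇒m<n∨m≡n C≤C'
    ... | inj₁ lt = lt
    ... | inj₂ refl with m≤n⇒m<n∨m≡n r<
    ... | inj₁ 1+r<m = ⊥-elim (<-irrefl refl (≤c' C l (to (galois 1+r<m l) (next-row 1+r<m))))
    ... | inj₂ refl = ⊥-elim (<-irrefl refl (≤c' C l (h-bound l)))

  -- The part of the ribbon still ahead: the corner itself, the lowest ones of the columns from `C`
  -- on, and the rightmost zeros of the rows below `r`.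
  Visited : ℕ → ℕ → ℕ → ℕ → Set
  Visited r C i j = (i ≡ r × j ≡ C ∸ 1) ⊎ (h j ≡ suc i × C ≤ j) ⊎ (z i ≡ suc j × r < i)

  segment⇔ : ∀ {a b} x l u → (a ≡ᵇ b) ∧ ((l ≤ᵇ x) ∧ (x ≤ᵇ u)) ≡ true ⇔ (a ≡ b × l ≤ x × x ≤ u)
  segment⇔ {a} {b} x l u = mk⇔
    (λ e → let p , q = to (∧⇔ {a ≡ᵇ b}) e ; q₁ , q₂ = to (∧⇔ {l ≤ᵇ x}) q in to ≡ᵇ⇔ p , to ≤ᵇ⇔ q₁ , to ≤ᵇ⇔ q₂)
    (λ (p , q₁ , q₂) → from ∧⇔ (from ≡ᵇ⇔ p , from ∧⇔ (from ≤ᵇ⇔ q₁ , from ≤ᵇ⇔ q₂)))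

  -- The bound `n ≤ C + f` survives each step because `C` grows until it reaches `n`. Once `n ≤ C`,
  -- no column is ahead and `Corner` leaves no row below `r`, so only the corner remains.
  walk⇔ : ∀ f r C → r < m → C ≤ n → Corner r C → n ≤ C + f
    → ∀ i j → i < m → j < n → walk P f r (C ∸ 1) i j ≡ true ⇔ Visited r C i j
  walk⇔ zero r C r< C≤n corner fuel i j i< j< = mk⇔
    (λ e → let p , q = to (∧⇔ {i ≡ᵇ r}) e in inj₁ (to ≡ᵇ⇔ p , to ≡ᵇ⇔ q))
    λ { (inj₁ (p , q)) → from ∧⇔ (from ≡ᵇ⇔ p , from (≡ᵇ⇔ {j}) q)
      ; (inj₂ (inj₁ (_ , le))) → ⊥-elim (<⇒≱ j< (≤-trans n≤C le))
      ; (inj₂ (inj₂ (_ , lt))) → ⊥-elim (<⇒≱ lt (from (corner i i<) (≤-trans (z-bound i<) n≤C))) }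
    where
    n≤C : n ≤ C
    n≤C = ≤-trans fuel (≤-reflexive (+-identityʳ C))
  walk⇔ (suc f) r C r< C≤n corner fuel i j i< j< = subst (λ w → w ≡ true ⇔ Visited r C i j) (sym unfold) (mk⇔ fwd bwd)
    where
    open Step r C r< C≤n corner
    unfold : walk P (suc f) r (C ∸ 1) i j ≡
      ((i ≡ᵇ r) ∧ ((C ∸ 1 ≤ᵇ j) ∧ (j ≤ᵇ c'))) ∨ (((j ≡ᵇ c') ∧ ((r ≤ᵇ i) ∧ (i ≤ᵇ r'))) ∨ walk P f r' c' i j)
    unfold rewrite rightmost≡ | lowest≡ = refl
    fuel' : n ≤ C' + f
    fuel' with m≤n⇒m<n∨m≡n C≤n
    ... | inj₁ C<n = ≤-trans fuel (≤-trans (≤-reflexive (+-suc C f)) (+-monoˡ-≤ f (progress C<n)))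
    ... | inj₂ refl = ≤-trans C≤C' (m≤m+n C' f)
    ih : walk P f r' c' i j ≡ true ⇔ Visited r' C' i j
    ih = walk⇔ f r' C' r'< c'< corner' fuel' i j i< j<
    horizontal : i ≡ r → C ∸ 1 ≤ j → j ≤ c' → Visited r C i j
    horizontal refl cj jc with m≤n⇒m<n∨m≡n cj
    ... | inj₂ e = inj₁ (refl , sym e)
    ... | inj₁ lt = inj₂ (inj₁ (≤-antisym (≤-trans (h-mono jc c'<) hc'≤) (C≤⇒h> j j< C≤j) , C≤j))
      where
      C≤j : C ≤ j
      C≤j = ≤-trans (m≤n+m∸n C 1) lt
    vertical : j ≡ c' → r ≤ i → i ≤ r' → Visited r C i j
    vertical refl ri ir with m≤n⇒m<n∨m≡n ri
    ... | inj₂ e = horizontal (sym e) c≤c' ≤-refl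
    ... | inj₁ lt = inj₂ (inj₂ (≤-antisym (to (corner' i i<) ir) (c'<z i i< lt) , lt))
    fwd : _ → Visited r C i j
    fwd e with to (∨⇔ {(i ≡ᵇ r) ∧ ((C ∸ 1 ≤ᵇ j) ∧ (j ≤ᵇ c'))}) e
    ... | inj₁ a = let p , q , s = to (segment⇔ j (C ∸ 1) c') a in horizontal p q s
    ... | inj₂ e₁ with to (∨⇔ {(j ≡ᵇ c') ∧ ((r ≤ᵇ i) ∧ (i ≤ᵇ r'))}) e₁
    ... | inj₁ a = let p , q , s = to (segment⇔ i r r') a in vertical p q s
    ... | inj₂ w with to ih w
    ... | inj₁ (p , q) = vertical q (≤-trans r≤r' (≤-reflexive (sym p))) (≤-reflexive p)
    ... | inj₂ (inj₁ (p , q)) = inj₂ (inj₁ (p , ≤-trans C≤C' q))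
    ... | inj₂ (inj₂ (p , q)) = inj₂ (inj₂ (p , ≤-<-trans r≤r' q))
    viaH : i ≡ r → C ∸ 1 ≤ j → j ≤ c' → _
    viaH p q s = from (∨⇔ {(i ≡ᵇ r) ∧ ((C ∸ 1 ≤ᵇ j) ∧ (j ≤ᵇ c'))}) (inj₁ (from (segment⇔ j (C ∸ 1) c') (p , q , s)))
    viaV : j ≡ c' → r ≤ i → i ≤ r' → _
    viaV p q s = from (∨⇔ {(i ≡ᵇ r) ∧ ((C ∸ 1 ≤ᵇ j) ∧ (j ≤ᵇ c'))}) (inj₂
      (from (∨⇔ {(j ≡ᵇ c') ∧ ((r ≤ᵇ i) ∧ (i ≤ᵇ r'))}) (inj₁ (from (segment⇔ i r r') (p , q , s)))))
    viaW : Visited r' C' i j → _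
    viaW v = from (∨⇔ {(i ≡ᵇ r) ∧ ((C ∸ 1 ≤ᵇ j) ∧ (j ≤ᵇ c'))}) (inj₂
      (from (∨⇔ {(j ≡ᵇ c') ∧ ((r ≤ᵇ i) ∧ (i ≤ᵇ r'))}) (inj₂ (from ih v))))
    bwd : Visited r C i j → _
    bwd (inj₁ (p , q)) = viaH p (≤-reflexive (sym q)) (≤-trans (≤-reflexive q) c≤c')
    bwd (inj₂ (inj₁ (p , q))) with ≤-<-connex j c'
    ... | inj₁ jc = viaH (suc-injective (≤-antisym (≤-trans (≤-reflexive (sym p)) (≤-trans (h-mono jc c'<) hc'≤))
                           (≤-trans (C≤⇒h> j j< q) (≤-reflexive p)))) (≤-trans (m∸n≤m C 1) q) jc
    ... | inj₂ cj = viaW (inj₂ (inj₁ (p , cj)))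
    bwd (inj₂ (inj₂ (p , q))) with ≤-<-connex i r'
    ... | inj₁ ir = viaV (suc-injective (≤-antisym (≤-trans (≤-reflexive (sym p)) (to (corner' i i<) ir))
                           (≤-trans (c'<z i i< q) (≤-reflexive p)))) (<⇒≤ q) ir
    ... | inj₂ ri = viaW (inj₂ (inj₂ (p , ri)))

  bounce-ribbon : IsRibbon (bounce P) z h
  bounce-ribbon i j i< j< = subst (λ w → w ≡ true ⇔ _) (sym (ent-mkMat (walk P (m + n) 0 0) i j i< j<)) (mk⇔ fwd bwd)
    where
    start : Corner 0 0
    start zero i< = mk⇔ (λ _ → ≤-reflexive z-zero) (λ _ → z≤n)
    start (suc i) i< = mk⇔ (λ ()) (λ le → ⊥-elim (<⇒≱ (z-pos (s≤s z≤n) i<) le))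
    w⇔ : walk P (m + n) 0 0 i j ≡ true ⇔ Visited 0 0 i j
    w⇔ = walk⇔ (m + n) 0 0 0<m z≤n start (m≤n+m n m) i j i< j<
    fwd : _ → h j ≡ suc i ⊎ z i ≡ suc j
    fwd e with to w⇔ e
    ... | inj₁ (refl , refl) = inj₁ h-first
    ... | inj₂ (inj₁ (p , _)) = inj₁ p
    ... | inj₂ (inj₂ (p , _)) = inj₂ p
    bwd : h j ≡ suc i ⊎ z i ≡ suc j → _
    bwd (inj₁ p) = from w⇔ (inj₂ (inj₁ (p , z≤n)))
    bwd (inj₂ p) = from w⇔ (inj₂ (inj₂ (p , n≢0⇒n>0 λ { refl → 0≢1+n (trans (sym z-zero) p) })))

-- The sorting procedure of φ

module _ {m n : ℕ} (T : Mat m n) where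

  rowZeros colOnes : ℕ → ℕ
  rowZeros x = countN n (λ y → not (ent T x y))
  colOnes y = countN m (λ x → ent T x y)

  rowZeros-root : IsEW T → rowZeros 0 ≡ 0
  rowZeros-root ew = countN-none n _ λ y y< e → false⇒¬true (to not⇔ e) (proj₁ ew y y<)

  sortedEnt : Labelling m n → ℕ → ℕ → Bool
  sortedEnt (rl , cl) i j = ent T (label 0 rl i) (label m cl j)

  phiRule : Labelling m n → ℕ → ℕ → Bool
  phiRule ℓ i j =
      (sortedEnt ℓ i j ∧ ((suc i ≡ᵇ m) ∨ not (sortedEnt ℓ (suc i) j)))
    ∨ (not (sortedEnt ℓ i j) ∧ ((suc j ≡ᵇ n) ∨ sortedEnt ℓ i (suc j)))

-- The labelling is asked to sort sizes only weakly, with no rule for ties, so that both the order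
-- of φ(T) and the order by starts in `D` are covered.
module SortedEW {m n : ℕ} (0<m : 0 < m) (0<n : 0 < n) (T : Mat m n) (ew : IsEW T)
  (rl : Vec ℕ m) (cl : Vec ℕ n) (lab : IsLabelling (rl , cl))
  (row-mono : Monotone m (rowZeros T ∘ label 0 rl)) (col-mono : Monotone n (colOnes T ∘ label m cl)) where

  open EW T ew public

  rows : Perm m (label 0 rl) (place 0 rl)
  rows = perm-of 0 rl (proj₁ lab)
  cols : Perm n (label m cl) (place m cl)
  cols = perm-of m cl (proj₂ lab)

  module R = Perm rows
  module C = Perm cols

  z h : ℕ → ℕ
  z i = rowZeros T (label 0 rl i)
  h j = colOnes T (label m cl j)

  ent-false⇔ : ∀ {x j} → x < m → j < n → ent T x (label m cl j) ≡ false ⇔ j < rowZeros T x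
  ent-false⇔ {x} {j} x< j< = mk⇔ (λ e → to count (from not⇔ e)) (λ l → to not⇔ (from count l))
    where
    count : not (ent T x (label m cl j)) ≡ true ⇔ j < rowZeros T x
    count = C.down-count (λ y → not (ent T x y)) (λ j j' le j< e → down j j' le j< e) j j<
      where
      down : ∀ j j' → j' ≤ j → j < n → not (ent T x (label m cl j)) ≡ true → not (ent T x (label m cl j')) ≡ true
      down j j' le j< e with dichotomy (ent T x (label m cl j'))
      ... | inj₂ f = from not⇔ f
      ... | inj₁ t = ⊥-elim (<⇒≱ (Col.size-< (C.s< (≤-<-trans le j<)) (C.s< j<) x< t (to not⇔ e)) (col-mono le j<))

  ent-true⇔ : ∀ {i y} → i < m → y < n → ent T (label 0 rl i) y ≡ true ⇔ i < colOnes T y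
  ent-true⇔ {i} {y} i< y< = R.down-count (λ x → ent T x y) down i i<
    where
    down : ∀ i i' → i' ≤ i → i < m → ent T (label 0 rl i) y ≡ true → ent T (label 0 rl i') y ≡ true
    down i i' le i< e with dichotomy (ent T (label 0 rl i') y)
    ... | inj₁ t = t
    ... | inj₂ f = ⊥-elim (<⇒≱ (Row.size-< (R.s< (≤-<-trans le i<)) (R.s< i<) y< (from not⇔ f) (cong not e)) (row-mono le i<))

  rowZeros-pos : ∀ {x} → 1 ≤ x → x < m → 1 ≤ rowZeros T x
  rowZeros-pos {x} 1≤x x< with proj₁ (proj₂ ew) x 1≤x x<
  ... | y , y< , e = countN-pos n _ y y< (from not⇔ e)

  colOnes-pos : ∀ {y} → y < n → 1 ≤ colOnes T y
  colOnes-pos {y} y< = countN-pos m _ 0 0<m (proj₁ ew y y<)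

  private
    z-first : z 0 ≡ 0
    z-first = n≤0⇒n≡0 (≤-trans (row-mono z≤n (R.t< 0<m))
      (≤-reflexive (trans (cong (rowZeros T) (R.st 0<m)) (rowZeros-root T ew))))

  label-first : label 0 rl 0 ≡ 0
  label-first with m≤n⇒m<n∨m≡n (z≤n {label 0 rl 0})
  ... | inj₂ e = sym e
  ... | inj₁ l = ⊥-elim (<⇒≱ (rowZeros-pos l (R.s< 0<m)) (≤-reflexive z-first))

  label-pos : ∀ {i} → 1 ≤ i → i < m → 1 ≤ label 0 rl i
  label-pos 1≤i i< = n≢0⇒n>0 λ e → <⇒≢ 1≤i (R.s-inj _ _ 0<m i< (trans label-first (sym e)))

  ferrers : Ferrers m n z h
  ferrers = record
    { 0<m = 0<m ; 0<n = 0<n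
    ; z-zero = z-first
    ; z-pos = λ 1≤i i< → rowZeros-pos (label-pos 1≤i i<) (R.s< i<)
    ; z-bound = λ _ → countN-≤ n _
    ; h-pos = λ j< → colOnes-pos (C.s< j<)
    ; h-bound = λ _ → countN-≤ m _
    ; z-mono = row-mono ; h-mono = col-mono
    ; galois = λ {i} {j} i< j< → mk⇔
        (λ l → ≮⇒≥ λ l' → false⇒¬true (from (ent-false⇔ (R.s< i<) j<) l) (from (ent-true⇔ i< (C.s< j<)) l'))
        (λ le → to (ent-false⇔ (R.s< i<) j<) (¬true⇒false λ e → <⇒≱ (to (ent-true⇔ i< (C.s< j<)) e) le))
    }

  phiRule-ribbon : IsRibbon {m} {n} (mkMat (phiRule T (rl , cl))) z h
  phiRule-ribbon i j i< j< = subst (λ w → w ≡ true ⇔ (h j ≡ suc i ⊎ z i ≡ suc j)) (sym (ent-mkMat (phiRule T (rl , cl)) i j i< j<)) (mk⇔ fwd bwd)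
    where
    T' : ℕ → ℕ → Bool
    T' = sortedEnt T (rl , cl)
    one⇔ : ∀ {i j} → i < m → j < n → T' i j ≡ true ⇔ i < h j
    one⇔ i< j< = ent-true⇔ i< (C.s< j<)
    zero⇔ : ∀ {i j} → i < m → j < n → T' i j ≡ false ⇔ j < z i
    zero⇔ i< j< = ent-false⇔ (R.s< i<) j<
    open Ferrers ferrers using (galois; galois′; h-bound; z-bound)
    fwd : phiRule T (rl , cl) i j ≡ true → h j ≡ suc i ⊎ z i ≡ suc j
    fwd e with to (∨⇔ {T' i j ∧ ((suc i ≡ᵇ m) ∨ not (T' (suc i) j))}) e
    fwd e | inj₁ a with to (∧⇔ {T' i j}) a
    ... | p , q with to (∨⇔ {suc i ≡ᵇ m}) q
    ... | inj₁ last = inj₁ (≤-antisym (≤-trans (h-bound j<) (≤-reflexive (sym (to (≡ᵇ⇔ {suc i}) last)))) (to (one⇔ i< j<) p))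
    ... | inj₂ nx with m≤n⇒m<n∨m≡n i<
    ... | inj₁ 1+i< = inj₁ (≤-antisym (to (galois 1+i< j<) (to (zero⇔ 1+i< j<) (to not⇔ nx))) (to (one⇔ i< j<) p))
    ... | inj₂ refl = inj₁ (≤-antisym (h-bound j<) (to (one⇔ i< j<) p))
    fwd e | inj₂ a with to (∧⇔ {not (T' i j)}) a
    ... | p , q with to (∨⇔ {suc j ≡ᵇ n}) q
    ... | inj₁ last = inj₂ (≤-antisym (≤-trans (z-bound i<) (≤-reflexive (sym (to (≡ᵇ⇔ {suc j}) last)))) (to (zero⇔ i< j<) (to not⇔ p)))
    ... | inj₂ nx with m≤n⇒m<n∨m≡n j<
    ... | inj₁ 1+j< = inj₂ (≤-antisym (from (galois′ i< 1+j<) (to (one⇔ i< 1+j<) nx)) (to (zero⇔ i< j<) (to not⇔ p)))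
    ... | inj₂ refl = inj₂ (≤-antisym (z-bound i<) (to (zero⇔ i< j<) (to not⇔ p)))
    bwd : h j ≡ suc i ⊎ z i ≡ suc j → phiRule T (rl , cl) i j ≡ true
    bwd (inj₁ e) = from (∨⇔ {T' i j ∧ ((suc i ≡ᵇ m) ∨ not (T' (suc i) j))}) (inj₁ (from ∧⇔
        (from (one⇔ i< j<) (≤-reflexive (sym e)) , from (∨⇔ {suc i ≡ᵇ m}) (step (m≤n⇒m<n∨m≡n i<)))))
      where
      step : suc i < m ⊎ suc i ≡ m → (suc i ≡ᵇ m) ≡ true ⊎ not (T' (suc i) j) ≡ true
      step (inj₂ q) = inj₁ (from (≡ᵇ⇔ {suc i}) q)
      step (inj₁ l) = inj₂ (from not⇔ (from (zero⇔ l j<) (from (galois l j<) (≤-reflexive e))))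
    bwd (inj₂ e) = from (∨⇔ {T' i j ∧ ((suc i ≡ᵇ m) ∨ not (T' (suc i) j))}) (inj₂ (from (∧⇔ {not (T' i j)})
        (from not⇔ (from (zero⇔ i< j<) (≤-reflexive (sym e))) , from (∨⇔ {suc j ≡ᵇ n}) (step (m≤n⇒m<n∨m≡n j<)))))
      where
      step : suc j < n ⊎ suc j ≡ n → (suc j ≡ᵇ n) ≡ true ⊎ T' i (suc j) ≡ true
      step (inj₂ q) = inj₁ (from (≡ᵇ⇔ {suc j}) q)
      step (inj₁ l) = inj₂ (from (one⇔ i< l) (to (galois′ i< l) (≤-reflexive e)))

module _ {m n : ℕ} (T : Mat m n) (ew : IsEW T) (rl : Vec ℕ m) (cl : Vec ℕ n) where
  open EW T ew

  private
    vat-< : ∀ {j j'} → IsLabelling (rl , cl) → j < n → j' < n → vat cl j < vat cl j' ⇔ label m cl j < label m cl j'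
    vat-< {j} {j'} lab j< j'< = mk⇔
      (λ l → +-cancelˡ-< m _ _ (subst₂ _<_ (vat-label m cl (proj₂ lab) _ j<) (vat-label m cl (proj₂ lab) _ j'<) l))
      (λ l → subst₂ _<_ (sym (vat-label m cl (proj₂ lab) _ j<)) (sym (vat-label m cl (proj₂ lab) _ j'<)) (+-monoʳ-< m l))

  -- Nested lines of equal size are identical. The conditions of `IsPhi` on entries and on identical
  -- lines thus amount to sorting by size with ties broken by label.
  phi⇒sorted : ∀ R → IsPhi T (R , (rl , cl)) →
    IsLabelling (rl , cl) × LexSorted 0 (rowZeros T) rl × LexSorted m (colOnes T) cl × R ≡ mkMat (phiRule T (rl , cl))
  phi⇒sorted R (lab , left , colTie , up , rowTie , R≡) = lab , rowLex , colLex , R≡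
    where
    module P = Perm (perm-of 0 rl (proj₁ lab))
    module Q = Perm (perm-of m cl (proj₂ lab))
    up' : ∀ i i' → i < i' → i' < m → ∀ y → y < n → not (ent T (vat rl i) y) ≡ true → not (ent T (vat rl i') y) ≡ true
    up' i i' l i'< y y< e with dichotomy (ent T (vat rl i') y)
    ... | inj₂ f = from not⇔ f
    ... | inj₁ t = ⊥-elim (false⇒¬true (to not⇔ e) (subst (λ w → ent T (vat rl i) w ≡ true) (Q.st y<)
            (up i i' (place m cl y) l i'< (Q.t< y<) (subst (λ w → ent T (vat rl i') w ≡ true) (sym (Q.st y<)) t))))
    rowLex : LexSorted 0 (rowZeros T) rl
    rowLex i i' l i'< with m≤n⇒m<n∨m≡n (countN-mono n _ _ (up' i i' l i'<))
    ... | inj₁ lt = inj₁ lt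
    ... | inj₂ e = inj₂ (e , rowTie i i' l i'< λ j j< → bool-ext
        (λ t → same j j< t) (λ t → up i i' j l i'< j< t))
      where
      same : ∀ j → j < n → ent T (vat rl i) (label m cl j) ≡ true → ent T (vat rl i') (label m cl j) ≡ true
      same j j< t with dichotomy (ent T (vat rl i') (label m cl j))
      ... | inj₁ t' = t'
      ... | inj₂ f = ⊥-elim (false⇒¬true (to not⇔ (Row.size-≤ (P.s< i'<) (P.s< (<-trans l i'<)) (Q.s< j<)
              (≤-reflexive (sym e)) (from not⇔ f))) t)
    right : ∀ j j' → j < j' → j' < n → ∀ x → x < m → ent T x (label m cl j) ≡ true → ent T x (label m cl j') ≡ true
    right j j' l j'< x x< e with dichotomy (ent T x (label m cl j'))
    ... | inj₁ t = t
    ... | inj₂ f = ⊥-elim (false⇒¬true (left x j j' x< l j'< f) e)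
    colLex : LexSorted m (colOnes T) cl
    colLex j j' l j'< with m≤n⇒m<n∨m≡n (countN-mono m _ _ (right j j' l j'<))
    ... | inj₁ lt = inj₁ lt
    ... | inj₂ e = inj₂ (e , to (vat-< lab (<-trans l j'<) j'<) (colTie j j' l j'< λ x x< → bool-ext
        (right j j' l j'< x x<)
        (Col.size-≤ (Q.s< j'<) (Q.s< (<-trans l j'<)) x< (≤-reflexive (sym e)))))

  sorted⇒phi : ∀ R → IsLabelling (rl , cl) → LexSorted 0 (rowZeros T) rl → LexSorted m (colOnes T) cl
    → R ≡ mkMat (phiRule T (rl , cl)) → IsPhi T (R , (rl , cl))
  sorted⇒phi R lab rowLex colLex R≡ = lab , left , colTie , up , rowTie , R≡
    where
    module P = Perm (perm-of 0 rl (proj₁ lab))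
    module Q = Perm (perm-of m cl (proj₂ lab))
    left : ∀ x j' j → x < m → j' < j → j < n → ent T x (label m cl j) ≡ false → ent T x (label m cl j') ≡ false
    left x j' j x< l j< f = ¬true⇒false λ t →
      <⇒≱ (Col.size-< (Q.s< (<-trans l j<)) (Q.s< j<) x< t f) (LexOrder.lex⇒≤ (colOnes T) (colLex j' j l j<))
    colTie : ∀ j j' → j < j' → j' < n → (∀ x → x < m → ent T x (label m cl j) ≡ ent T x (label m cl j')) → vat cl j < vat cl j'
    colTie j j' l j'< same with colLex j j' l j'<
    ... | inj₁ lt = ⊥-elim (<⇒≢ lt (countN-ext m _ _ λ x x< → mk⇔ (trans (sym (same x x<))) (trans (same x x<))))
    ... | inj₂ (_ , lt) = from (vat-< lab (<-trans l j'<) j'<) lt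
    up : ∀ i' i j → i' < i → i < m → j < n → ent T (vat rl i) (label m cl j) ≡ true → ent T (vat rl i') (label m cl j) ≡ true
    up i' i j l i< j< t with dichotomy (ent T (vat rl i') (label m cl j))
    ... | inj₁ t' = t'
    ... | inj₂ f = ⊥-elim (<⇒≱ (Row.size-< (P.s< (<-trans l i<)) (P.s< i<) (Q.s< j<) (from not⇔ f) (cong not t))
             (LexOrder.lex⇒≤ (rowZeros T) (rowLex i' i l i<)))
    rowTie : ∀ i i' → i < i' → i' < m → (∀ j → j < n → ent T (vat rl i) (label m cl j) ≡ ent T (vat rl i') (label m cl j)) → vat rl i < vat rl i'
    rowTie i i' l i'< same with rowLex i i' l i'<
    ... | inj₂ (_ , lt) = lt
    ... | inj₁ lt = ⊥-elim (<⇒≢ lt (countN-ext n _ _ λ y y< → mk⇔ (trans (cong not (sym (same' y y<)))) (trans (cong not (same' y y<)))))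
      where
      same' : ∀ y → y < n → ent T (vat rl i) y ≡ ent T (vat rl i') y
      same' y y< = subst (λ w → ent T (vat rl i) w ≡ ent T (vat rl i') w) (Q.st y<) (same (place m cl y) (Q.t< y<))

-- Parallelogram polyominoes

-- The polyomino with given leftmost and topmost ones is connected
-- when row i reaches the leftmost one of row i + 1.
record Parking (m n : ℕ) (lft top : ℕ → ℕ) : Set where
  field
    0<m      : 0 < m
    0<n      : 0 < n
    lft-zero : lft 0 ≡ 0
    top-zero : top 0 ≡ 0
    lft<     : ∀ {i} → i < m → lft i < n
    top<     : ∀ {j} → j < n → top j < m
    lft-mono : Monotone m lft
    top-mono : Monotone n top
    reach    : ∀ {i} → suc i < m → top (lft (suc i)) ≤ i

fits⇒parking : ∀ {m n z h lft top} → Ferrers m n z h → Fits m n z h lft top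
  → Monotone m lft → Monotone n top → Parking m n lft top
fits⇒parking {m} {n} {z} {h} {lft} {top} F fits lm tm = record
  { 0<m = 0<m ; 0<n = 0<n ; lft-zero = lft-zero
  ; top-zero = n<1⇒n≡0 (subst (top 0 <_) h-first (top<h 0<n))
  ; lft< = lft<n
  ; top< = λ j< → <-≤-trans (top<h j<) (h-bound j<)
  ; lft-mono = lm ; top-mono = tm
  -- Column `lft (suc i)` is a zero of row `i + 1` in the sorted tableau, so it has at most `i + 1`
  -- ones and starts at or above row `i`.
  ; reach = λ 1+i< → ≤-pred (≤-trans (top<h (lft<n 1+i<)) (to (galois 1+i< (lft<n 1+i<)) (lft<z (s≤s z≤n) 1+i<)))
  }
  where
  open Ferrers F
  open Fits fits
  lft<n : ∀ {i} → i < m → lft i < n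
  lft<n {zero}  _  = subst (_< n) (sym lft-zero) 0<n
  lft<n {suc i} i< = <-≤-trans (lft<z (s≤s z≤n) i<) (z-bound i<)

module ParkingPoly {m n : ℕ} {lft top : ℕ → ℕ} (park : Parking m n lft top) where
  open Parking park

  P : Mat m n
  P = poly lft top

  row-start : ∀ {i} → i < m → ent P i (lft i) ≡ true
  row-start {zero} i< = from (poly⇔ lft top i< (lft< i<))
    (≤-refl , ≤-reflexive (trans (cong top lft-zero) top-zero))
  row-start {suc i} i< = from (poly⇔ lft top i< (lft< i<)) (≤-refl , m≤n⇒m≤1+n (reach i<))

  -- If row `top j = i + 1` started to the right of `j`, monotonicity and `reach` would give
  -- `top j ≤ top (lft (suc i)) ≤ i`.
  col-start : ∀ {j} → j < n → ent P (top j) j ≡ true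
  col-start {j} j< = from (poly⇔ lft top (top< j<) j<) (bound (top j) refl , ≤-refl)
    where
    bound : ∀ i → top j ≡ i → lft (top j) ≤ j
    bound zero e = ≤-trans (≤-reflexive (trans (cong lft e) lft-zero)) z≤n
    bound (suc i) e = ≮⇒≥ λ l → <⇒≱ (≤-reflexive (sym e))
      (≤-trans (top-mono (<⇒≤ l) (lft< (top< j<)))
               (≤-trans (≤-reflexive (cong (λ w → top (lft w)) e)) (reach (subst (_< m) e (top< j<)))))

  leftmost-poly : ∀ i → i < m → leftmost P i ≡ lft i
  leftmost-poly i i< = firstTrue-unique n _ (lft i) (lft< i<) (row-start i<)
    λ j l e → <⇒≱ l (proj₁ (to (poly⇔ lft top i< (<-trans l (lft< i<))) e))

  topmost-poly : ∀ j → j < n → topmost P j ≡ top j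
  topmost-poly j j< = firstTrue-unique m _ (top j) (top< j<) (col-start j<)
    λ i l e → <⇒≱ l (proj₂ (to (poly⇔ lft top (<-trans l (top< j<)) j<) e))

  poly-para : IsParaPoly P
  poly-para =
      from (poly⇔ lft top 0<m 0<n) (≤-reflexive lft-zero , ≤-reflexive top-zero)
    , from (poly⇔ lft top m-1< n-1<)
        (≤-pred (≤-trans (lft< m-1<) (≤-reflexive (sym 1+n-1))) , ≤-pred (≤-trans (top< n-1<) (≤-reflexive (sym 1+m-1))))
    , (λ i i< → lft i , lft< i< , row-start i<)
    , (λ i j₁ j j₂ i< l₁ l₂ j₂< e₁ e₂ → from (poly⇔ lft top i< (≤-<-trans l₂ j₂<))
        ( ≤-trans (proj₁ (to (poly⇔ lft top i< (≤-<-trans l₁ (≤-<-trans l₂ j₂<))) e₁)) l₁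
        , ≤-trans (top-mono l₂ j₂<) (proj₂ (to (poly⇔ lft top i< j₂<) e₂))))
    , (λ i 1+i< → subst₂ _≤_ (sym (leftmost-poly i (<⇒≤ 1+i<))) (sym (leftmost-poly (suc i) 1+i<)) (lft-mono (n≤1+n i) 1+i<)
        , subst (_≤ rightmost P i) (sym (leftmost-poly (suc i) 1+i<)) (next i 1+i<)
        , lastTrue-≥ n _ (rightmost P i) (lastTrue-< n _ 0<n) (from (poly⇔ lft top 1+i< (lastTrue-< n _ 0<n))
            ( next i 1+i<
            , m≤n⇒m≤1+n (proj₂ (to (poly⇔ lft top (<⇒≤ 1+i<) (lastTrue-< n _ 0<n))
                (lastTrue-holds n (λ j → ent P i j) (lft i) (lft< (<⇒≤ 1+i<)) (row-start (<⇒≤ 1+i<))))))))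
    where
    1+m-1 : suc (m ∸ 1) ≡ m
    1+m-1 = m+[n∸m]≡n 0<m
    1+n-1 : suc (n ∸ 1) ≡ n
    1+n-1 = m+[n∸m]≡n 0<n
    m-1< : m ∸ 1 < m
    m-1< = ≤-reflexive 1+m-1
    n-1< : n ∸ 1 < n
    n-1< = ≤-reflexive 1+n-1
    next : ∀ i → suc i < m → lft (suc i) ≤ rightmost P i
    next i 1+i< = lastTrue-≥ n _ (lft (suc i)) (lft< 1+i<)
      (from (poly⇔ lft top (<⇒≤ 1+i<) (lft< 1+i<)) (lft-mono (n≤1+n i) 1+i< , reach 1+i<))

module ParaPoly {m n : ℕ} (0<m : 0 < m) (0<n : 0 < n) (P : Mat m n) (para : IsParaPoly P) where

  private
    ℓ ρ τ : ℕ → ℕ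
    ℓ = leftmost P
    ρ = rightmost P
    τ = topmost P

    nonempty : ∀ i → i < m → ∃ λ j → j < n × ent P i j ≡ true
    nonempty = proj₁ (proj₂ (proj₂ para))

    connected : ∀ i → suc i < m → ℓ i ≤ ℓ (suc i) × ℓ (suc i) ≤ ρ i × ρ i ≤ ρ (suc i)
    connected = proj₂ (proj₂ (proj₂ (proj₂ para)))

    ℓ< : ∀ {i} → i < m → ℓ i < n
    ℓ< {i} i< = let j , j< , e = nonempty i i< in ≤-<-trans (firstTrue-≤ n _ j e) j<

    ρ< : ∀ {i} → ρ i < n
    ρ< = lastTrue-< n _ 0<n

    ent-ℓ : ∀ {i} → i < m → ent P i (ℓ i) ≡ true
    ent-ℓ {i} i< = let j , j< , e = nonempty i i< in firstTrue-holds n (λ j → ent P i j) j j< e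

    ent-ρ : ∀ {i} → i < m → ent P i (ρ i) ≡ true
    ent-ρ {i} i< = let j , j< , e = nonempty i i< in lastTrue-holds n (λ j → ent P i j) j j< e

    between : ∀ {i j} → i < m → ℓ i ≤ j → j ≤ ρ i → ent P i j ≡ true
    between {i} {j} i< l l' = proj₁ (proj₂ (proj₂ (proj₂ para))) i (ℓ i) j (ρ i) i< l l' ρ< (ent-ℓ i<) (ent-ρ i<)

    chain : ∀ (f : ℕ → ℕ) → (∀ i → suc i < m → f i ≤ f (suc i)) → Monotone m f
    chain f step {i} {zero}   z≤n _ = ≤-refl
    chain f step {i} {suc i'} l i'< with m≤n⇒m<n∨m≡n l
    ... | inj₂ refl = ≤-refl
    ... | inj₁ l' = ≤-trans (chain f step (≤-pred l') (<⇒≤ i'<)) (step i' i'<)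

  leftmost-mono : Monotone m ℓ
  leftmost-mono = chain ℓ λ i l → proj₁ (connected i l)

  rightmost-mono : Monotone m ρ
  rightmost-mono = chain ρ λ i l → proj₂ (proj₂ (connected i l))

  private
    -- Row `i + 1` starts no later than row `i` ends, so a column passed between the two ends lies
    -- in row `i + 1`; the last row ends at column `n ∸ 1`, so every column is passed.
    col-nonempty : ∀ j → j < n → ∃ λ i → i < m × ent P i j ≡ true
    col-nonempty j j< with search (m ∸ 1) (≤-reflexive 1+m-1)
      where
      1+m-1 : suc (m ∸ 1) ≡ m
      1+m-1 = m+[n∸m]≡n 0<m
      search : ∀ i → i < m → (∃ λ i → i < m × ent P i j ≡ true) ⊎ ρ i < j
      search i i< with ≤-<-connex j (ρ i)
      ... | inj₂ l = inj₂ l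
      search zero i< | inj₁ l = inj₁ (0 , i< , between i<
        (≤-trans (firstTrue-≤ n _ 0 (proj₁ para)) z≤n) l)
      search (suc i) i< | inj₁ l with search i (<⇒≤ i<)
      ... | inj₁ r = inj₁ r
      ... | inj₂ l' = inj₁ (suc i , i< , between i< (≤-trans (proj₁ (proj₂ (connected i i<))) (<⇒≤ l')) l)
    ... | inj₁ r = r
    ... | inj₂ l = ⊥-elim (<⇒≱ l (≤-trans (m<n⇒m≤n-1 j<)
        (lastTrue-≥ n _ (n ∸ 1) (≤-reflexive (m+[n∸m]≡n 0<n)) (proj₁ (proj₂ para)))))
      where
      m<n⇒m≤n-1 : ∀ {a b} → a < b → a ≤ b ∸ 1
      m<n⇒m≤n-1 (s≤s l) = l

  topmost< : ∀ {j} → j < n → τ j < m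
  topmost< {j} j< = let i , i< , e = col-nonempty j j< in ≤-<-trans (firstTrue-≤ m _ i e) i<

  private
    ent-τ : ∀ {j} → j < n → ent P (τ j) j ≡ true
    ent-τ j< = firstTrue-bounded m _ (topmost< j<)

  -- The right boundary is implied: row `τ j` extends at least to `j`, and right ends only move
  -- right further down.
  para⇔ : ∀ {i j} → i < m → j < n → ent P i j ≡ true ⇔ (ℓ i ≤ j × τ j ≤ i)
  para⇔ {i} {j} i< j< = mk⇔ (λ e → firstTrue-≤ n _ j e , firstTrue-≤ m _ i e)
    λ (l , l') → between i< l (≤-trans (lastTrue-≥ n _ j j< (ent-τ j<)) (rightmost-mono l' i<))

  -- If column `j'` started above column `j`, its top row would start at or before `j` and extend to
  -- `j'`, so it would contain `j` too.
  topmost-mono : Monotone n τ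
  topmost-mono {j} {j'} l j'< with ≤-<-connex (τ j) (τ j')
  ... | inj₁ le = le
  ... | inj₂ lt = ⊥-elim (<⇒≱ lt (firstTrue-≤ m _ (τ j')
      (between (topmost< j'<) (≤-trans (leftmost-mono (<⇒≤ lt) (topmost< (≤-<-trans l j'<))) (firstTrue-≤ n _ j (ent-τ (≤-<-trans l j'<))))
        (≤-trans l (lastTrue-≥ n _ j' j'< (ent-τ j'<))))))

  para-parking : Parking m n ℓ τ
  para-parking = record
    { 0<m = 0<m ; 0<n = 0<n
    ; lft-zero = n≤0⇒n≡0 (firstTrue-≤ n _ 0 (proj₁ para))
    ; top-zero = n≤0⇒n≡0 (firstTrue-≤ m _ 0 (proj₁ para))
    ; lft< = ℓ< ; top< = topmost< ; lft-mono = leftmost-mono ; top-mono = topmost-mono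
    ; reach = λ {i} 1+i< → firstTrue-≤ m _ i
        (between (<⇒≤ 1+i<) (proj₁ (connected i 1+i<)) (proj₁ (proj₂ (connected i 1+i<))))
    }

-- Labelled polyominoes from starting positions

rowStart : ∀ {m n} → LabPoly m n → ℕ → ℕ
rowStart (P , (rl , _)) x = leftmost P (place 0 rl x)

colStart : ∀ {m n} → LabPoly m n → ℕ → ℕ
colStart {m} (P , (_ , cl)) y = topmost P (place m cl y)

sortedPoly : ∀ {m n} → (L U : ℕ → ℕ) → LabPoly m n
sortedPoly {m} {n} L U = poly (L ∘ label 0 rl) (U ∘ label m cl) , (rl , cl)
  where
  rl : Vec ℕ m
  rl = Sort.vec m L 0
  cl : Vec ℕ n
  cl = Sort.vec n U m

-- The label conditions of `IsLPara` make both labellings lexicographically sorted by start, so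
-- `vec-unique` determines them; `para⇔` then recovers the cells from the starts.
para-unique : ∀ {m n} → 0 < m → 0 < n → (D : LabPoly m n) → IsLPara D → ∀ {L U}
  → (∀ x → x < m → rowStart D x ≡ L x) → (∀ y → y < n → colStart D y ≡ U y) → D ≡ sortedPoly L U
para-unique {m} {n} 0<m 0<n (P , (rl , cl)) (para , lab , _ , rowTie , colTie) {L} {U} eL eU =
  cong₂ _,_ P≡ (cong₂ _,_ rl≡ cl≡)
  where
  open ParaPoly 0<m 0<n P para
  module R = Perm (perm-of 0 rl (proj₁ lab))
  module C = Perm (perm-of m cl (proj₂ lab))
  lft≡ : ∀ i → i < m → leftmost P i ≡ L (label 0 rl i)
  lft≡ i i< = trans (cong (leftmost P) (sym (R.ts i<))) (eL _ (R.s< i<))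
  top≡ : ∀ j → j < n → topmost P j ≡ U (label m cl j)
  top≡ j j< = trans (cong (topmost P) (sym (C.ts j<))) (eU _ (C.s< j<))
  rowLex : LexSorted 0 L rl
  rowLex i i' l i'< with m≤n⇒m<n∨m≡n (leftmost-mono (<⇒≤ l) i'<)
  ... | inj₁ lt = inj₁ (subst₂ _<_ (lft≡ i (<-trans l i'<)) (lft≡ i' i'<) lt)
  ... | inj₂ e = inj₂ (trans (sym (lft≡ i (<-trans l i'<))) (trans e (lft≡ i' i'<)) , rowTie i i' l i'< e)
  colLex : LexSorted m U cl
  colLex j j' l j'< with m≤n⇒m<n∨m≡n (topmost-mono (<⇒≤ l) j'<)
  ... | inj₁ lt = inj₁ (subst₂ _<_ (top≡ j (<-trans l j'<)) (top≡ j' j'<) lt)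
  ... | inj₂ e = inj₂ (trans (sym (top≡ j (<-trans l j'<))) (trans e (top≡ j' j'<)) ,
      +-cancelˡ-< m _ _ (subst₂ _<_ (vat-label m cl (proj₂ lab) j (<-trans l j'<)) (vat-label m cl (proj₂ lab) j' j'<) (colTie j j' l j'< e)))
  rl≡ : rl ≡ Sort.vec m L 0
  rl≡ = Sort.vec-unique m L 0 rl (proj₁ lab) rowLex
  cl≡ : cl ≡ Sort.vec n U m
  cl≡ = Sort.vec-unique n U m cl (proj₂ lab) colLex
  lft top : ℕ → ℕ
  lft = L ∘ label 0 (Sort.vec m L 0)
  top = U ∘ label m (Sort.vec n U m)
  lft≡' : ∀ i → i < m → leftmost P i ≡ lft i
  lft≡' i i< = trans (lft≡ i i<) (cong (λ v → L (label 0 v i)) rl≡)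
  top≡' : ∀ j → j < n → topmost P j ≡ top j
  top≡' j j< = trans (top≡ j j<) (cong (λ v → U (label m v j)) cl≡)
  P≡ : P ≡ poly lft top
  P≡ = ent-ext P _ λ i j i< j< → bool-ext
    (λ e → let a , b = to (para⇔ i< j<) e in from (poly⇔ lft top i< j<)
        (subst (_≤ j) (lft≡' i i<) a , subst (_≤ i) (top≡' j j<) b))
    (λ e → let a , b = to (poly⇔ lft top i< j<) e in from (para⇔ i< j<)
        (subst (_≤ j) (sym (lft≡' i i<)) a , subst (_≤ i) (sym (top≡' j j<)) b))

-- `Z⁻ ≤ L` and `H⁻ ≤ U` are stated against all smaller sizes instead of through cornersupport. In
-- this form they can be read off a burning process and transported to sorted positions as `Fits`.
record Compatible {m n : ℕ} (T : Mat m n) (L U : ℕ → ℕ) : Set where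
  field
    L-root   : L 0 ≡ 0
    L<zeros  : ∀ {x} → 1 ≤ x → x < m → L x < rowZeros T x
    zeros≤L  : ∀ {x x'} → 1 ≤ x → x < m → x' < m → rowZeros T x' < rowZeros T x → rowZeros T x' ≤ L x
    U<ones   : ∀ {y} → y < n → U y < colOnes T y
    ones≤U   : ∀ {y y'} → y < n → y' < n → colOnes T y' < colOnes T y → colOnes T y' ≤ U y

sameRun : ∀ {k f} → Monotone k f → ∀ {i i'} → i < k → i' < k → f i ≡ f i' → SameRun f i i'
sameRun {k} {f} mono {i} {i'} i< i'< e t l l' with ≤-total i i'
... | inj₁ le = ≤-antisym (≤-trans (mono t≤i' i'<) (≤-reflexive (sym e))) (mono i≤t (≤-<-trans t≤i' i'<))
  where
  i≤t : i ≤ t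
  i≤t = subst (_≤ t) (m≤n⇒m⊓n≡m le) l
  t≤i' : t ≤ i'
  t≤i' = subst (t ≤_) (m≤n⇒m⊔n≡n le) l'
... | inj₂ le = ≤-antisym (mono t≤i i<) (≤-trans (≤-reflexive e) (mono i'≤t (≤-<-trans t≤i i<)))
  where
  i'≤t : i' ≤ t
  i'≤t = subst (_≤ t) (m≥n⇒m⊓n≡n le) l
  t≤i : t ≤ i
  t≤i = subst (t ≤_) (m≥n⇒m⊔n≡m le) l'

sameRun⇒≡ : ∀ {f i i'} → SameRun f i i' → f i' ≡ f i
sameRun⇒≡ {f} {i} {i'} run = run i' (m⊓n≤n i i') (m≤n⊔m i i')

-- The witness is the position where `v` carries the label `v'` has at `i`. Both positions have the
-- same `f`, because `f` depends only on the label, and a monotone `f` is constant between them.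
blockwise : ∀ {k} base (v v' : Vec ℕ k) (pv : IsPermFrom base v) (pv' : IsPermFrom base v') (K f : ℕ → ℕ)
  → Monotone k f → (∀ i → i < k → f i ≡ K (label base v i)) → (∀ i → i < k → f i ≡ K (label base v' i))
  → ∀ i → i < k → ∃ λ i' → i' < k × SameRun f i i' × vat v' i ≡ vat v i'
blockwise {k} base v v' pv pv' K f mono fv fv' i i< =
  i' , i'< , sameRun mono i< i'< (trans (fv' i i<) (trans (cong K (sym (V.st x<))) (sym (fv i' i'<))))
  , trans (vat-label base v' pv' i i<) (trans (cong (base +_) (sym (V.st x<))) (sym (vat-label base v pv i' i'<)))
  where
  module V = Perm (perm-of base v pv)
  x i' : ℕ
  x = label base v' i
  i' = place base v x
  x< : x < k
  x< = Perm.s< (perm-of base v' pv') i<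
  i'< : i' < k
  i'< = V.t< x<

module Realise {m n : ℕ} (0<m : 0 < m) (0<n : 0 < n) (T : Mat m n) (ew : IsEW T)
  {L U : ℕ → ℕ} (comp : Compatible T L U) where
  open Compatible comp

  D E : LabPoly m n
  D = sortedPoly L U
  E = mkMat (phiRule T ℓ) , ℓ
    where
    ℓ : Labelling m n
    ℓ = Sort.vec m (rowZeros T) 0 , Sort.vec n (colOnes T) m

  P Q : Mat m n
  P = proj₁ D
  Q = proj₁ E
  rl rl' : Vec ℕ m
  rl = proj₁ (proj₂ D)
  rl' = proj₁ (proj₂ E)
  cl cl' : Vec ℕ n
  cl = proj₂ (proj₂ D)
  cl' = proj₂ (proj₂ E)

  lab : IsLabelling (rl , cl)
  lab = Sort.vec-perm m L 0 , Sort.vec-perm n U m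
  lab' : IsLabelling (rl' , cl')
  lab' = Sort.vec-perm m (rowZeros T) 0 , Sort.vec-perm n (colOnes T) m

  module RL = Perm (perm-of 0 rl (proj₁ lab))
  module CL = Perm (perm-of m cl (proj₂ lab))

  -- Sorting by start also sorts by size: `Z x' < Z x` would give `L x' < Z x' ≤ L x`, against the
  -- order of the starts.
  row-order : ∀ {x x'} → x < m → x' < m → Lex L x x' → rowZeros T x ≤ rowZeros T x'
  row-order {zero} _ _ _ = ≤-trans (≤-reflexive (rowZeros-root T ew)) z≤n
  row-order {suc x} {zero} _ _ (inj₁ lt) = ⊥-elim (n≮0 (subst (L (suc x) <_) L-root lt))
  row-order {suc x} {zero} _ _ (inj₂ (_ , ()))
  row-order {suc x} {suc x'} x< x'< lx = ≮⇒≥ λ lt →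
    <⇒≱ (<-≤-trans (L<zeros (s≤s z≤n) x'<) (zeros≤L (s≤s z≤n) x< x'< lt)) (LexOrder.lex⇒≤ L lx)

  col-order : ∀ {y y'} → y < n → y' < n → Lex U y y' → colOnes T y ≤ colOnes T y'
  col-order y< y'< lx = ≮⇒≥ λ lt →
    <⇒≱ (<-≤-trans (U<ones y'<) (ones≤U y< y'< lt)) (LexOrder.lex⇒≤ U lx)

  row-mono : Monotone m (rowZeros T ∘ label 0 rl)
  row-mono {i} {i'} l i'< with m≤n⇒m<n∨m≡n l
  ... | inj₂ refl = ≤-refl
  ... | inj₁ lt = row-order (RL.s< (<-trans lt i'<)) (RL.s< i'<) (Sort.vec-lex m L 0 i i' lt i'<)

  col-mono : Monotone n (colOnes T ∘ label m cl)
  col-mono {j} {j'} l j'< with m≤n⇒m<n∨m≡n l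
  ... | inj₂ refl = ≤-refl
  ... | inj₁ lt = col-order (CL.s< (<-trans lt j'<)) (CL.s< j'<) (Sort.vec-lex n U m j j' lt j'<)

  row-mono' : Monotone m (rowZeros T ∘ label 0 rl')
  row-mono' = lex-monotone (rowZeros T) (Sort.vec-lex m (rowZeros T) 0)
  col-mono' : Monotone n (colOnes T ∘ label m cl')
  col-mono' = lex-monotone (colOnes T) (Sort.vec-lex n (colOnes T) m)

  module SD = SortedEW 0<m 0<n T ew rl cl lab row-mono col-mono
  module SE = SortedEW 0<m 0<n T ew rl' cl' lab' row-mono' col-mono'

  z≡ : ∀ i → i < m → SD.z i ≡ SE.z i
  z≡ = rearrangement {K = rowZeros T} SD.rows SE.rows row-mono row-mono'
  h≡ : ∀ j → j < n → SD.h j ≡ SE.h j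
  h≡ = rearrangement {K = colOnes T} SD.cols SE.cols col-mono col-mono'

  lft top : ℕ → ℕ
  lft = L ∘ label 0 rl
  top = U ∘ label m cl

  lft-mono : Monotone m lft
  lft-mono = lex-monotone L (Sort.vec-lex m L 0)
  top-mono : Monotone n top
  top-mono = lex-monotone U (Sort.vec-lex n U m)

  fits : Fits m n SD.z SD.h lft top
  fits = record
    { lft-zero = trans (cong L SD.label-first) L-root
    ; lft<z = λ 1≤i i< → L<zeros (SD.label-pos 1≤i i<) (RL.s< i<)
    ; z≤lft = λ 1≤i i< i'< → zeros≤L (SD.label-pos 1≤i i<) (RL.s< i<) (RL.s< i'<)
    ; top<h = λ j< → U<ones (CL.s< j<)
    ; h≤top = λ j< j'< → ones≤U (CL.s< j<) (CL.s< j'<)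
    }

  open ParkingPoly (fits⇒parking SD.ferrers fits lft-mono top-mono) using (leftmost-poly; topmost-poly; poly-para)

  D-para : IsLPara D
  D-para = poly-para , lab , SD.label-first
    , (λ i i' l i'< e → row-tie i i' l i'< (subst₂ _≡_ (leftmost-poly i (<-trans l i'<)) (leftmost-poly i' i'<) e))
    , (λ j j' l j'< e → col-tie j j' l j'< (subst₂ _≡_ (topmost-poly j (<-trans l j'<)) (topmost-poly j' j'<) e))
    where
    row-tie : ∀ i i' → i < i' → i' < m → lft i ≡ lft i' → vat rl i < vat rl i'
    row-tie i i' l i'< e with Sort.vec-lex m L 0 i i' l i'<
    ... | inj₁ lt = ⊥-elim (<⇒≢ lt e)
    ... | inj₂ (_ , lt) = lt
    col-tie : ∀ j j' → j < j' → j' < n → top j ≡ top j' → vat cl j < vat cl j'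
    col-tie j j' l j'< e with Sort.vec-lex n U m j j' l j'<
    ... | inj₁ lt = ⊥-elim (<⇒≢ lt e)
    ... | inj₂ (_ , lt) = subst₂ _<_ (sym (vat-label m cl (proj₂ lab) j (<-trans l j'<)))
                            (sym (vat-label m cl (proj₂ lab) j' j'<)) (+-monoʳ-< m lt)

  rowStart-D : ∀ x → x < m → rowStart D x ≡ L x
  rowStart-D x x< = trans (leftmost-poly _ (RL.t< x<)) (cong L (RL.st x<))

  colStart-D : ∀ y → y < n → colStart D y ≡ U y
  colStart-D y y< = trans (topmost-poly _ (CL.t< y<)) (cong U (CL.st y<))

  bounce-ribbon : IsRibbon (bounce P) SD.z SD.h
  bounce-ribbon = Bounce.bounce-ribbon SD.ferrers fits

  D-phi : IsPhi T E
  D-phi = sorted⇒phi T ew rl' cl' Q lab' (Sort.vec-lex m (rowZeros T) 0) (Sort.vec-lex n (colOnes T) m) refl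

  -- A ribbon is determined by the sizes in each position, and these agree for the two orders. Since
  -- `f` and `g` are monotone, runs are classes of equal `Kr` or `Kc`, so rearranging labels within
  -- runs turns one order into the other.
  D-bounce : IsB D E
  D-bounce = ribbon-unique {z = SD.z} {SD.h} Q (bounce P)
      (λ i j i< j< → subst₂ (λ a b → ent Q i j ≡ true ⇔ (a ≡ suc i ⊎ b ≡ suc j)) (sym (h≡ j j<)) (sym (z≡ i i<))
                       (SE.phiRule-ribbon i j i< j<))
      bounce-ribbon
    , blockwise 0 rl rl' (proj₁ lab) (proj₁ lab') Kr f f-mono f-rl f-rl'
    , blockwise 0 rl' rl (proj₁ lab') (proj₁ lab) Kr f f-mono f-rl' f-rl
    , row-run
    , blockwise m cl cl' (proj₂ lab) (proj₂ lab') Kc g g-mono g-cl g-cl'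
    , blockwise m cl' cl (proj₂ lab') (proj₂ lab) Kc g g-mono g-cl' g-cl
    , col-run
    where
    f g Kr Kc : ℕ → ℕ
    f = leftmost (bounce P)
    g = topmost (bounce P)
    Kr x = rowZeros T x ∸ 1
    Kc y = colOnes T y ∸ 1
    f-rl : ∀ i → i < m → f i ≡ SD.z i ∸ 1
    f-rl = ribbon-leftmost SD.ferrers (bounce P) bounce-ribbon
    f-rl' : ∀ i → i < m → f i ≡ SE.z i ∸ 1
    f-rl' i i< = trans (f-rl i i<) (cong (_∸ 1) (z≡ i i<))
    g-cl : ∀ j → j < n → g j ≡ SD.h j ∸ 1
    g-cl = ribbon-topmost SD.ferrers (bounce P) bounce-ribbon
    g-cl' : ∀ j → j < n → g j ≡ SE.h j ∸ 1
    g-cl' j j< = trans (g-cl j j<) (cong (_∸ 1) (h≡ j j<))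
    f-mono : Monotone m f
    f-mono l i'< = subst₂ _≤_ (sym (f-rl _ (≤-<-trans l i'<))) (sym (f-rl _ i'<)) (∸-monoˡ-≤ 1 (row-mono l i'<))
    g-mono : Monotone n g
    g-mono l j'< = subst₂ _≤_ (sym (g-cl _ (≤-<-trans l j'<))) (sym (g-cl _ j'<)) (∸-monoˡ-≤ 1 (col-mono l j'<))
    pred-inj : ∀ {a b} → 1 ≤ a → 1 ≤ b → a ∸ 1 ≡ b ∸ 1 → a ≡ b
    pred-inj (s≤s _) (s≤s _) e = cong suc e
    row-run : ∀ i i' → i < i' → i' < m → SameRun f i i' → vat rl' i < vat rl' i'
    -- Truncation gives rows with no zero and rows with one zero the same start, so row 0 is
    -- separated by its label, which is the least.
    row-run zero i' l i'< run = subst (_< vat rl' i') (sym SE.label-first) (SE.label-pos l i'<)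
    row-run i@(suc _) i' l i'< run with Sort.vec-lex m (rowZeros T) 0 i i' l i'<
    ... | inj₂ (_ , lt) = lt
    ... | inj₁ lt = ⊥-elim (<⇒≢ lt (pred-inj
            (SE.rowZeros-pos (SE.label-pos (s≤s z≤n) i<) (SE.R.s< i<))
            (SE.rowZeros-pos (SE.label-pos (≤-trans (s≤s z≤n) l) i'<) (SE.R.s< i'<))
            (trans (sym (f-rl' i i<)) (trans (sym (sameRun⇒≡ {f} {i} run)) (f-rl' i' i'<)))))
      where
      i< : i < m
      i< = <-trans l i'<
    col-run : ∀ j j' → j < j' → j' < n → SameRun g j j' → vat cl' j < vat cl' j'
    col-run j j' l j'< run with Sort.vec-lex n (colOnes T) m j j' l j'<
    ... | inj₂ (_ , lt) = subst₂ _<_ (sym (vat-label m cl' (proj₂ lab') j (<-trans l j'<)))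
                            (sym (vat-label m cl' (proj₂ lab') j' j'<)) (+-monoʳ-< m lt)
    ... | inj₁ lt = ⊥-elim (<⇒≢ lt (pred-inj (SE.colOnes-pos (SE.C.s< (<-trans l j'<))) (SE.colOnes-pos (SE.C.s< j'<))
            (trans (sym (g-cl' j (<-trans l j'<))) (trans (sym (sameRun⇒≡ {g} {j} run)) (g-cl' j' j'<)))))

module Surplus {m n : ℕ} (0<m : 0 < m) (0<n : 0 < n) (T : Mat m n) (ew : IsEW T)
  (D E : LabPoly m n) (phi : IsPhi T E) where

  private
    Q : Mat m n
    Q = proj₁ E
    rl : Vec ℕ m
    rl = proj₁ (proj₂ E)
    cl : Vec ℕ n
    cl = proj₂ (proj₂ E)
    sorted : IsLabelling (rl , cl) × LexSorted 0 (rowZeros T) rl × LexSorted m (colOnes T) cl × Q ≡ mkMat (phiRule T (rl , cl))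
    sorted = phi⇒sorted T ew rl cl Q phi
    module S = SortedEW 0<m 0<n T ew rl cl (proj₁ sorted)
      (lex-monotone (rowZeros T) (proj₁ (proj₂ sorted)))
      (lex-monotone (colOnes T) (proj₁ (proj₂ (proj₂ sorted))))
    ribbon : IsRibbon Q S.z S.h
    ribbon = subst (λ R → IsRibbon R S.z S.h) (sym (proj₂ (proj₂ (proj₂ sorted)))) S.phiRule-ribbon

  rowStart-E : ∀ x → x < m → rowStart E x ≡ rowZeros T x ∸ 1
  rowStart-E x x< = trans (ribbon-leftmost S.ferrers Q ribbon _ (S.R.t< x<)) (cong (λ w → rowZeros T w ∸ 1) (S.R.st x<))

  colStart-E : ∀ y → y < n → colStart E y ≡ colOnes T y ∸ 1
  colStart-E y y< = trans (ribbon-topmost S.ferrers Q ribbon _ (S.C.t< y<)) (cong (λ w → colOnes T w ∸ 1) (S.C.st y<))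

  surp-row : ∀ x → x < m → surp D E x ≡ (ℤ.+ (rowZeros T x ∸ 1)) ℤ.- (ℤ.+ rowStart D x)
  surp-row x x< rewrite from (<ᵇ⇔ {x} {m}) x< = cong (λ w → (ℤ.+ w) ℤ.- (ℤ.+ rowStart D x)) (rowStart-E x x<)

  surp-col : ∀ y → y < n → surp D E (m + y) ≡ (ℤ.+ (colOnes T y ∸ 1)) ℤ.- (ℤ.+ colStart D y)
  surp-col y y< rewrite ¬true⇒false (λ e → m+n≮m m y (to (<ᵇ⇔ {m + y} {m}) e)) =
    cong (λ w → (ℤ.+ w) ℤ.- (ℤ.+ colStart D y)) (colStart-E y y<)

-- Recovering the tableau

-- Dhar's burning algorithm: the root row burns first; a column burns once more than U y
-- rows are burnt, a row x ≥ 1 once more than L x columns are burnt. The EW-tableau of (L , U)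
-- records with a 1 that the row burns before the column.
module Burning (m n : ℕ) (0<m : 0 < m) (0<n : 0 < n) (L U : ℕ → ℕ) where

  rowBurnt : ℕ → ℕ → Bool
  rowBurnt c x = (x ≡ᵇ 0) ∨ (L x <ᵇ c)

  rowsBelow colsBelow : ℕ → ℕ
  rowsBelow c = countN m (rowBurnt c)
  colsBelow r = countN n (λ y → U y <ᵇ r)

  -- The number of columns burnt at the beginning of round `k`, and the number of rows burnt as a
  -- consequence. At round 0 only the root row is burnt.
  stage rowsAt : ℕ → ℕ
  stage zero    = 0
  stage (suc k) = colsBelow (rowsAt k)
  rowsAt k = rowsBelow (stage k)

  -- Column `y` burns right after the rows of round `when y`, so its ones in `burnt` are the rows
  -- burnt by then. Rounds `0` to `n` are searched; `rowsAt-n` shows that they suffice.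
  when : ℕ → ℕ
  when y = firstTrue (suc n) (λ k → U y <ᵇ rowsAt k)

  burnt : Mat m n
  burnt = mkMat (λ x y → rowBurnt (stage (when y)) x)

  rowBurnt⇔ : ∀ {c x} → rowBurnt c x ≡ true ⇔ (x ≡ 0 ⊎ L x < c)
  rowBurnt⇔ {c} {x} = mk⇔ fwd bwd
    where
    fwd : rowBurnt c x ≡ true → x ≡ 0 ⊎ L x < c
    fwd e with to (∨⇔ {x ≡ᵇ 0}) e
    ... | inj₁ p = inj₁ (to ≡ᵇ⇔ p)
    ... | inj₂ p = inj₂ (to <ᵇ⇔ p)
    bwd : x ≡ 0 ⊎ L x < c → rowBurnt c x ≡ true
    bwd (inj₁ p) = from (∨⇔ {x ≡ᵇ 0}) (inj₁ (from ≡ᵇ⇔ p))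
    bwd (inj₂ p) = from (∨⇔ {x ≡ᵇ 0}) (inj₂ (from <ᵇ⇔ p))

  rowsBelow-mono : ∀ {c c'} → c ≤ c' → rowsBelow c ≤ rowsBelow c'
  rowsBelow-mono {c} {c'} le = countN-mono m _ _ λ x x< e → from rowBurnt⇔ (grow (to rowBurnt⇔ e))
    where
    grow : ∀ {x} → x ≡ 0 ⊎ L x < c → x ≡ 0 ⊎ L x < c'
    grow (inj₁ p) = inj₁ p
    grow (inj₂ p) = inj₂ (<-≤-trans p le)

  colsBelow-mono : ∀ {r r'} → r ≤ r' → colsBelow r ≤ colsBelow r'
  colsBelow-mono le = countN-mono n _ _ λ y y< e → from (<ᵇ⇔ {U y}) (<-≤-trans (to <ᵇ⇔ e) le)

  stage-step : ∀ k → stage k ≤ stage (suc k)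
  stage-step zero    = z≤n
  stage-step (suc k) = colsBelow-mono (rowsBelow-mono (stage-step k))

  stage-mono : ∀ k k' → k ≤ k' → stage k ≤ stage k'
  stage-mono k k' le with m≤n⇒m<n∨m≡n le
  ... | inj₂ refl = ≤-refl
  stage-mono k (suc k') le | inj₁ lt = ≤-trans (stage-mono k k' (≤-pred lt)) (stage-step k')

  rowsAt-mono : ∀ k k' → k ≤ k' → rowsAt k ≤ rowsAt k'
  rowsAt-mono k k' le = rowsBelow-mono (stage-mono k k' le)

  -- `spreads` is the statement that the fire never stalls while a column is unburnt.
  module Complete (L< : ∀ {x} → x < m → L x < n) (U< : ∀ {y} → y < n → U y < m)
    (spreads : ∀ {c} → c < n → c < colsBelow (rowsBelow c)) where

    stage-≥ : ∀ k → k ≤ n → k ≤ stage k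
    stage-≥ zero    _  = z≤n
    stage-≥ (suc k) k< with stage k <? n
    ... | yes lt = ≤-trans (s≤s (stage-≥ k (<⇒≤ k<))) (spreads lt)
    ... | no ≮n = ≤-trans k< (≤-trans (≮⇒≥ ≮n) (stage-step k))

    rowsAt-n : m ≤ rowsAt n
    rowsAt-n = ≤-reflexive (sym (countN-all m _ λ x x< → from rowBurnt⇔ (inj₂ (<-≤-trans (L< x<) (stage-≥ n ≤-refl)))))

    when-burnt : ∀ {y} → y < n → U y < rowsAt (when y)
    when-burnt {y} y< = to <ᵇ⇔ (firstTrue-holds (suc n) (λ k → U y <ᵇ rowsAt k) n ≤-refl
                           (from <ᵇ⇔ (<-≤-trans (U< y<) rowsAt-n)))

    when-least : ∀ y k → U y < rowsAt k → when y ≤ k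
    when-least y k lt = firstTrue-≤ (suc n) (λ k → U y <ᵇ rowsAt k) k (from <ᵇ⇔ lt)

    burnt⇔ : ∀ {x y} → x < m → y < n → ent burnt x y ≡ true ⇔ (x ≡ 0 ⊎ L x < stage (when y))
    burnt⇔ {x} {y} x< y< = subst (λ w → w ≡ true ⇔ (x ≡ 0 ⊎ L x < stage (when y)))
      (sym (ent-mkMat (λ x y → rowBurnt (stage (when y)) x) x y x< y<)) rowBurnt⇔

    burnt-zero : ∀ {x y} → x < m → y < n → ent burnt x y ≡ false → stage (when y) ≤ L x
    burnt-zero x< y< e = ≮⇒≥ λ lt → false⇒¬true e (from (burnt⇔ x< y<) (inj₂ lt))

    burnt-one : ∀ {x y} → 1 ≤ x → x < m → y < n → ent burnt x y ≡ true → L x < stage (when y)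
    burnt-one 1≤x x< y< e with to (burnt⇔ x< y<) e
    ... | inj₁ refl = ⊥-elim (n≮0 1≤x)
    ... | inj₂ lt = lt

    burnt-colOnes : ∀ {y} → y < n → colOnes burnt y ≡ rowsAt (when y)
    burnt-colOnes {y} y< = countN-ext m _ _ λ x x< → mk⇔
      (λ e → from rowBurnt⇔ (to (burnt⇔ x< y<) e)) (λ e → from (burnt⇔ x< y<) (to rowBurnt⇔ e))

    -- The two consecutive stages that enclose `L x`; they turn out to bound the gap in which the
    -- start of row `x` may move.
    level : ∀ {x} → x < m → ∃ λ κ → stage κ ≤ L x × L x < stage (suc κ)
    level {x} x< = search n (<-≤-trans (L< x<) (stage-≥ n ≤-refl))
      where
      search : ∀ k → L x < stage k → ∃ λ κ → stage κ ≤ L x × L x < stage (suc κ)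
      search (suc k) lt with L x <? stage k
      ... | yes lt' = search k lt'
      ... | no ≮s = k , ≮⇒≥ ≮s , lt

    -- The zeros of row `x` are the columns that burn before it. The fire reaches the row only after
    -- stage `κ + 1`, when `stage (suc κ)` columns are burnt.
    burnt-rowZeros : ∀ {x} → 1 ≤ x → (x< : x < m) → rowZeros burnt x ≡ stage (suc (proj₁ (level x<)))
    burnt-rowZeros {x} 1≤x x< = countN-ext n _ _ λ y y< → mk⇔
      (λ e → from (<ᵇ⇔ {U y}) (<-≤-trans (when-burnt y<) (rowsAt-mono (when y) κ (≤-pred (≰⇒> λ le →
          <⇒≱ above (≤-trans (stage-mono (suc κ) (when y) le) (burnt-zero x< y< (to not⇔ e))))))))
      (λ e → from not⇔ (¬true⇒false λ t → <⇒≱ (burnt-one 1≤x x< y< t)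
          (≤-trans (stage-mono (when y) κ (when-least y κ (to (<ᵇ⇔ {U y}) e))) below)))
      where
      κ : ℕ
      κ = proj₁ (level x<)
      below : stage κ ≤ L x
      below = proj₁ (proj₂ (level x<))
      above : L x < stage (suc κ)
      above = proj₂ (proj₂ (level x<))

    burnt-ew : IsEW burnt
    burnt-ew = (λ y y< → from (burnt⇔ 0<m y<) (inj₁ refl)) , has-zero , no-corner
      where
      has-zero : ∀ x → 1 ≤ x → x < m → ∃ λ y → y < n × ent burnt x y ≡ false
      has-zero x 1≤x x< with countN-witness n (λ _ → false) (λ y → not (ent burnt x y))
        (subst₂ _<_ (sym (countN-none n _ (λ _ _ ()))) (sym (burnt-rowZeros 1≤x x<)) (≤-<-trans z≤n (proj₂ (proj₂ (level x<)))))
      ... | y , y< , e , _ = y , y< , to not⇔ e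
      no-corner : ∀ x x' y y' → x < m → x' < m → y < n → y' < n → x ≢ x' → y ≢ y' →
        ent burnt x y ≡ false → ent burnt x' y' ≡ false → ent burnt x y' ≡ true → ent burnt x' y ≡ true → ⊥
      no-corner x x' y y' x< x'< y< y'< _ _ a b c d with to (burnt⇔ x< y'<) c | to (burnt⇔ x'< y<) d
      ... | inj₁ p | _ = false⇒¬true a (from (burnt⇔ x< y<) (inj₁ p))
      ... | _ | inj₁ p = false⇒¬true b (from (burnt⇔ x'< y'<) (inj₁ p))
      -- A forbidden corner is a cycle of burning times: row `x` before column `y'` before row `x'`
      -- before column `y` before row `x`.
      ... | inj₂ p | inj₂ q = <-irrefl refl (<-≤-trans p (≤-trans (burnt-zero x'< y'< b)
              (<⇒≤ (<-≤-trans q (burnt-zero x< y< a)))))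

    -- Row sizes of `burnt` are stages and column sizes are values of `rowsAt`. A row smaller than
    -- `x` has a level below `κ`, so its size is at most `stage κ`, which is at most `L x`.
    burnt-compatible : L 0 ≡ 0 → Compatible burnt L U
    burnt-compatible L-root = record
      { L-root = L-root
      ; L<zeros = λ {x} 1≤x x< → subst (L x <_) (sym (burnt-rowZeros 1≤x x<)) (proj₂ (proj₂ (level x<)))
      ; zeros≤L = zeros≤L
      ; U<ones = λ {y} y< → subst (U y <_) (sym (burnt-colOnes y<)) (when-burnt y<)
      ; ones≤U = λ {y} {y'} y< y'< lt → subst (_≤ U y) (sym (burnt-colOnes y'<)) (≮⇒≥ λ lt' →
          <⇒≱ (subst₂ _<_ (burnt-colOnes y'<) (burnt-colOnes y<) lt) (rowsAt-mono (when y) (when y') (when-least y (when y') lt')))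
      }
      where
      zeros≤L : ∀ {x x'} → 1 ≤ x → x < m → x' < m → rowZeros burnt x' < rowZeros burnt x → rowZeros burnt x' ≤ L x
      zeros≤L {x} {zero} 1≤x x< x'< lt = ≤-trans (≤-reflexive (rowZeros-root burnt burnt-ew)) z≤n
      zeros≤L {x} {suc x'} 1≤x x< x'< lt = subst (_≤ L x) (sym (burnt-rowZeros (s≤s z≤n) x'<))
        (≤-trans (stage-mono (suc κ') κ (≰⇒> λ le → <⇒≱ (subst₂ _<_ (burnt-rowZeros (s≤s z≤n) x'<) (burnt-rowZeros 1≤x x<) lt)
                    (stage-mono (suc κ) (suc κ') (s≤s le)))) (proj₁ (proj₂ (level x<))))
        where
        κ κ' : ℕ
        κ = proj₁ (level x<)
        κ' = proj₁ (level x'<)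

    module _ (T : Mat m n) (ew : IsEW T) (comp : Compatible T L U) where
      open Compatible comp
      private module S = Realise.SE 0<m 0<n T ew comp
      open Realise 0<m 0<n T ew comp using (rl'; cl')

      private
        -- These say that burning sees only the sizes of lines of `T`: the burnt lines are those of
        -- size at most the current count, wherever in its gap each start lies. The rounds are
        -- thereby expressed through `T` alone.
        RowInv ColInv : ℕ → Set
        RowInv k = ∀ x → x < m → (x ≡ 0 ⊎ L x < stage k) ⇔ rowZeros T x ≤ stage k
        ColInv k = ∀ y → y < n → U y < rowsAt k ⇔ colOnes T y ≤ rowsAt k

        rowsAt≡ : ∀ k → RowInv k → rowsAt k ≡ countN m (λ x → rowZeros T x ≤ᵇ stage k)
        rowsAt≡ k inv = countN-ext m _ _ λ x x< → mk⇔
          (λ e → from ≤ᵇ⇔ (to (inv x x<) (to rowBurnt⇔ e))) (λ e → from rowBurnt⇔ (from (inv x x<) (to ≤ᵇ⇔ e)))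

        stage≡ : ∀ k → ColInv k → stage (suc k) ≡ countN n (λ y → colOnes T y ≤ᵇ rowsAt k)
        stage≡ k inv = countN-ext n _ _ λ y y< → mk⇔
          (λ e → from ≤ᵇ⇔ (to (inv y y<) (to <ᵇ⇔ e))) (λ e → from (<ᵇ⇔ {U y}) (from (inv y y<) (to ≤ᵇ⇔ e)))

        ≰ᵇ⇒> : ∀ {a b} → (a ≤ᵇ b) ≡ false → b < a
        ≰ᵇ⇒> e = ≰⇒> λ le → false⇒¬true e (from ≤ᵇ⇔ le)

        -- The column in position stage k of the sorted tableau has exactly rowsAt k ones.
        colInv : ∀ k → RowInv k → ColInv k
        colInv k inv y y< = mk⇔ (λ lt → ≮⇒≥ λ lt' → <⇒≱ lt (late lt')) (λ le → <-≤-trans (U<ones y<) le)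
          where
          late : rowsAt k < colOnes T y → rowsAt k ≤ U y
          late lt with countN-witness m _ (λ x → ent T x y) (subst (_< colOnes T y) (rowsAt≡ k inv) lt)
          ... | x , x< , _ , f = subst (_≤ U y) ones≡ (ones≤U y< (S.C.s< C<n) (subst (_< colOnes T y) (sym ones≡) lt))
            where
            C<n : stage k < n
            C<n = <-≤-trans (≰ᵇ⇒> {rowZeros T x} f) (countN-≤ n _)
            ones≡ : colOnes T (label m cl' (stage k)) ≡ rowsAt k
            ones≡ = trans (countN-ext m _ _ λ x x< → mk⇔
                (λ t → from ≤ᵇ⇔ (≮⇒≥ λ l → false⇒¬true (from (S.ent-false⇔ x< C<n) l) t))
                (λ e → case x x< (to ≤ᵇ⇔ e))) (sym (rowsAt≡ k inv))
              where
              case : ∀ x → x < m → rowZeros T x ≤ stage k → ent T x (label m cl' (stage k)) ≡ true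
              case x x< le with dichotomy (ent T x (label m cl' (stage k)))
              ... | inj₁ t = t
              ... | inj₂ f = ⊥-elim (<⇒≱ (to (S.ent-false⇔ x< C<n) f) le)

        -- Dual to the column step: the row in position `rowsAt k` of the sorted tableau has exactly
        -- `stage (suc k)` zeros, so larger rows have their starts at or beyond that value.
        rowInv-suc : ∀ k → ColInv k → RowInv (suc k)
        rowInv-suc k inv x x< = mk⇔ fwd bwd
          where
          late : 1 ≤ x → stage (suc k) < rowZeros T x → stage (suc k) ≤ L x
          -- The witness is a column with more than `rowsAt k` ones; it shows `rowsAt k < m`, so
          -- that position exists.
          late 1≤x lt with countN-witness n _ (λ y → not (ent T x y)) (subst (_< rowZeros T x) (stage≡ k inv) lt)
          ... | y , y< , _ , f = subst (_≤ L x) zeros≡ (zeros≤L 1≤x x< (S.R.s< r<m) (subst (_< rowZeros T x) (sym zeros≡) lt))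
            where
            r<m : rowsAt k < m
            r<m = <-≤-trans (≰ᵇ⇒> {colOnes T y} f) (countN-≤ m _)
            zeros≡ : rowZeros T (label 0 rl' (rowsAt k)) ≡ stage (suc k)
            zeros≡ = trans (countN-ext n _ _ λ y y< → mk⇔
                (λ e → from ≤ᵇ⇔ (≮⇒≥ λ l → false⇒¬true (to not⇔ e) (from (S.ent-true⇔ r<m y<) l)))
                (λ e → from not⇔ (¬true⇒false λ t → <⇒≱ (to (S.ent-true⇔ r<m y<) t) (to ≤ᵇ⇔ e)))) (sym (stage≡ k inv))
          fwd : x ≡ 0 ⊎ L x < stage (suc k) → rowZeros T x ≤ stage (suc k)
          fwd (inj₁ refl) = ≤-trans (≤-reflexive (rowZeros-root T ew)) z≤n
          fwd (inj₂ lt) with m≤n⇒m<n∨m≡n (z≤n {x})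
          ... | inj₂ refl = ≤-trans (≤-reflexive (rowZeros-root T ew)) z≤n
          ... | inj₁ 1≤x = ≮⇒≥ λ lt' → <⇒≱ lt (late 1≤x lt')
          bwd : rowZeros T x ≤ stage (suc k) → x ≡ 0 ⊎ L x < stage (suc k)
          bwd le with m≤n⇒m<n∨m≡n (z≤n {x})
          ... | inj₂ e = inj₁ (sym e)
          ... | inj₁ 1≤x = inj₂ (<-≤-trans (L<zeros 1≤x x<) le)

        rowInv : ∀ k → RowInv k
        rowInv zero x x< = mk⇔ (λ { (inj₁ refl) → ≤-reflexive (rowZeros-root T ew) }) bwd
          where
          bwd : rowZeros T x ≤ 0 → x ≡ 0 ⊎ L x < 0
          bwd le with m≤n⇒m<n∨m≡n (z≤n {x})
          ... | inj₂ e = inj₁ (sym e)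
          ... | inj₁ 1≤x = ⊥-elim (<⇒≱ (S.rowZeros-pos 1≤x x<) le)
        rowInv (suc k) = rowInv-suc k (colInv k (rowInv k))

        -- A one of `y` in a row larger than `stage k` would, by nestedness, come on top of ones in
        -- all `rowsAt k` smaller rows, too many for column `y`. A zero of `x` at `y` comes on top
        -- of zeros in all columns burnt before `y`, so `x` has more than `stage k` zeros.
        ent⇔ : ∀ {x y} → x < m → y < n → ent T x y ≡ true ⇔ rowZeros T x ≤ stage (when y)
        ent⇔ {x} {y} x< y< = mk⇔ fwd bwd
          where
          k : ℕ
          k = when y
          fwd : ent T x y ≡ true → rowZeros T x ≤ stage k
          fwd e = ≮⇒≥ λ lt → <⇒≱ (countN-strict m (λ x' → rowZeros T x' ≤ᵇ stage k) (λ x' → ent T x' y) x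
              (λ x' x'< le → included x' x'< (≤-<-trans (to ≤ᵇ⇔ le) lt))
              x< e (¬true⇒false λ le → <⇒≱ lt (to ≤ᵇ⇔ le)))
            (≤-trans (to (colInv k (rowInv k) y y<) (when-burnt y<)) (≤-reflexive (rowsAt≡ k (rowInv k))))
            where
            included : ∀ x' → x' < m → rowZeros T x' < rowZeros T x → ent T x' y ≡ true
            included x' x'< lt with dichotomy (ent T x' y)
            ... | inj₁ t = t
            ... | inj₂ f = ⊥-elim (<-asym lt (S.Row.size-< x'< x< y< (from not⇔ f) (cong not e)))
          bwd : rowZeros T x ≤ stage k → ent T x y ≡ true
          bwd le with dichotomy (ent T x y)
          ... | inj₁ t = t
          ... | inj₂ f = ⊥-elim (<⇒≱ (more (when y) refl) le)
            where
            more : ∀ k → when y ≡ k → stage k < rowZeros T x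
            more zero _ = countN-pos n _ y y< (from not⇔ f)
            more (suc k) e = subst (_< rowZeros T x) (sym (stage≡ k (colInv k (rowInv k))))
              (countN-strict n _ _ y (λ y' y'< le → included y' y'< (≤-<-trans (to ≤ᵇ⇔ le) late)) y< (from not⇔ f)
                 (¬true⇒false λ le → <⇒≱ late (to ≤ᵇ⇔ le)))
              where
              late : rowsAt k < colOnes T y
              late = ≰⇒> λ le → <⇒≱ (≤-reflexive (sym e)) (when-least y k (from (colInv k (rowInv k) y y<) le))
              included : ∀ y' → y' < n → colOnes T y' < colOnes T y → not (ent T x y') ≡ true
              included y' y'< lt = from not⇔ (¬true⇒false λ t → <-asym lt (S.Col.size-< y'< y< x< t f))

      compatible-unique : T ≡ burnt
      compatible-unique = ent-ext T burnt λ x y x< y< → bool-ext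
        (λ e → from (burnt⇔ x< y<) (from (rowInv (when y) x x<) (to (ent⇔ x< y<) e)))
        (λ e → from (ent⇔ x< y<) (to (rowInv (when y) x x<) (to (burnt⇔ x< y<) e)))

-- The starts of a labelled polyomino burn every line

module ParaStarts {m n : ℕ} (0<m : 0 < m) (0<n : 0 < n) (D : LabPoly m n) (para : IsLPara D) where
  private
    P : Mat m n
    P = proj₁ D
    rl : Vec ℕ m
    rl = proj₁ (proj₂ D)
    cl : Vec ℕ n
    cl = proj₂ (proj₂ D)
    lab : IsLabelling (rl , cl)
    lab = proj₁ (proj₂ para)
    module R = Perm (perm-of 0 rl (proj₁ lab))
    module C = Perm (perm-of m cl (proj₂ lab))
    label-first : label 0 rl 0 ≡ 0
    label-first = proj₁ (proj₂ (proj₂ para))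
  open ParaPoly 0<m 0<n P (proj₁ para)
  open Parking para-parking using (lft-zero; lft<; top<; lft-mono; top-mono)
  open Burning m n 0<m 0<n (rowStart D) (colStart D) using (rowBurnt; rowBurnt⇔; rowsBelow; colsBelow)

  rowStart-root : rowStart D 0 ≡ 0
  rowStart-root = trans (cong (leftmost P) (trans (cong (place 0 rl) (sym label-first)) (R.ts 0<m))) lft-zero

  rowStart< : ∀ {x} → x < m → rowStart D x < n
  rowStart< x< = lft< (R.t< x<)

  colStart< : ∀ {y} → y < n → colStart D y < m
  colStart< y< = top< (C.t< y<)

  private
    rowStart-label : ∀ {i} → i < m → rowStart D (label 0 rl i) ≡ leftmost P i
    rowStart-label i< = cong (leftmost P) (R.ts i<)

    rowsBelow⇔ : ∀ c i → i < m → (i ≡ 0 ⊎ leftmost P i < c) ⇔ i < rowsBelow c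
    rowsBelow⇔ c i i< = mk⇔ (λ b → to count (from (here i i<) b)) (λ l → to (here i i<) (from count l))
      where
      here : ∀ i → i < m → rowBurnt c (label 0 rl i) ≡ true ⇔ (i ≡ 0 ⊎ leftmost P i < c)
      here i i< = mk⇔ (λ e → fwd (to (rowBurnt⇔ {c}) e)) (λ b → from (rowBurnt⇔ {c}) (bwd b))
        where
        fwd : label 0 rl i ≡ 0 ⊎ rowStart D (label 0 rl i) < c → i ≡ 0 ⊎ leftmost P i < c
        fwd (inj₁ e) = inj₁ (R.s-inj i 0 i< 0<m (trans e (sym label-first)))
        fwd (inj₂ l) = inj₂ (subst (_< c) (rowStart-label i<) l)
        bwd : i ≡ 0 ⊎ leftmost P i < c → label 0 rl i ≡ 0 ⊎ rowStart D (label 0 rl i) < c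
        bwd (inj₁ refl) = inj₁ label-first
        bwd (inj₂ l) = inj₂ (subst (_< c) (sym (rowStart-label i<)) l)
      down : ∀ i i' → i' ≤ i → i < m → rowBurnt c (label 0 rl i) ≡ true → rowBurnt c (label 0 rl i') ≡ true
      down i i' le i< e with to (here i i<) e
      ... | inj₁ refl = from (here i' (≤-<-trans le i<)) (inj₁ (n≤0⇒n≡0 le))
      ... | inj₂ lt = from (here i' (≤-<-trans le i<)) (inj₂ (≤-<-trans (lft-mono le i<) lt))
      count : rowBurnt c (label 0 rl i) ≡ true ⇔ i < rowsBelow c
      count = R.down-count (rowBurnt c) down i i<

    colsBelow⇐ : ∀ r j → j < n → topmost P j < r → j < colsBelow r
    colsBelow⇐ r j j< lt = to (C.down-count (λ y → colStart D y <ᵇ r) down j j<) (from (here j j<) lt)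
      where
      here : ∀ j → j < n → (colStart D (label m cl j) <ᵇ r) ≡ true ⇔ topmost P j < r
      here j j< = subst (λ w → (w <ᵇ r) ≡ true ⇔ topmost P j < r) (sym (cong (topmost P) (C.ts j<))) <ᵇ⇔
      down : ∀ j j' → j' ≤ j → j < n → (colStart D (label m cl j) <ᵇ r) ≡ true → (colStart D (label m cl j') <ᵇ r) ≡ true
      down j j' le j< e = from (here j' (≤-<-trans le j<)) (≤-<-trans (top-mono le j<) (to (here j j<) e))

  -- With `c` columns burnt, the top row of sorted column `c` is burnt, being the root or starting
  -- strictly left of `c`; so are all rows above it, and hence column `c` burns.
  spreads : ∀ {c} → c < n → c < colsBelow (rowsBelow c)
  spreads {c} c< = colsBelow⇐ _ c c< (to (rowsBelow⇔ c (topmost P c) (top< c<)) (reached (topmost P c) refl))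
    where
    reached : ∀ i → topmost P c ≡ i → topmost P c ≡ 0 ⊎ leftmost P (topmost P c) < c
    reached zero e = inj₁ e
    -- The start is strictly left of `c`: if row `i + 1` started at `c` itself, row `i` would reach
    -- `c` as well and column `c` would not begin at row `i + 1`.
    reached (suc i) e = inj₂ (≤∧≢⇒< (proj₁ (to (para⇔ (top< c<) c<) (firstTrue-bounded m _ (top< c<))))
      λ e' → <⇒≱ (≤-reflexive (sym e)) (subst (λ w → topmost P w ≤ i) (trans (cong (leftmost P) (sym e)) e')
        (Parking.reach para-parking (subst (_< m) e (top< c<)))))

  open Burning.Complete m n 0<m 0<n (rowStart D) (colStart D) rowStart< colStart< spreads public

-- The bijection

module _ {m n : ℕ} (T : Mat m n) where

  -- `rowFixed` and `colFixed` are `smaller` of `Row` and `Col` by computation, restated without a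
  -- proof of `IsEW` so that the keys are defined on all of `MEWData`.
  rowFixed colFixed rowFree colFree : ℕ → ℕ
  rowFixed x = countN n (λ y → not (ent T x y) ∧ cornersupport T x y)
  colFixed y = countN m (λ x → ent T x y ∧ cornersupport T x y)
  rowFree x = countN n (λ y → not (ent T x y) ∧ not (cornersupport T x y))
  colFree y = countN m (λ x → ent T x y ∧ not (cornersupport T x y))

  rowFixed+rowFree : ∀ x → rowFixed x + rowFree x ≡ rowZeros T x
  rowFixed+rowFree x = countN-split n (λ y → not (ent T x y)) (cornersupport T x)

  colFixed+colFree : ∀ y → colFixed y + colFree y ≡ colOnes T y
  colFixed+colFree y = countN-split m (λ x → ent T x y) (λ x → cornersupport T x y)

  eta-row : ∀ {x} → 1 ≤ x → x < m → eta T x ≡ rowFree x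
  eta-row {x} 1≤x x< rewrite from (≤ᵇ⇔ {1} {x}) 1≤x | from (<ᵇ⇔ {x} {m}) x< = refl

  eta-col : ∀ {y} → y < n → eta T (m + y) ≡ colFree y
  eta-col {y} y<
    rewrite ¬true⇒false (λ e → m+n≮m m y (to (<ᵇ⇔ {m + y} {m}) (proj₂ (to (∧⇔ {1 ≤ᵇ m + y}) e))))
          | from (≤ᵇ⇔ {m} {m + y}) (m≤m+n m y)
          | from (<ᵇ⇔ {m + y} {m + n}) (+-monoʳ-< m y<)
          | m+n∸m≡n m y = refl

rowKey colKey : ∀ {m n} → MEWData m n → ℕ → ℕ
rowKey (T , a) zero    = 0
rowKey (T , a) (suc q) = rowFixed T (suc q) + vat a q
colKey {m} (T , a) y = colFixed T y + vat a (m + y ∸ 1)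

aget≡vat : ∀ {k} (a : Vec ℕ k) p → aget a p ≡ vat a (toℕ p)
aget≡vat (x ∷ a) Fin.zero    = refl
aget≡vat (x ∷ a) (Fin.suc p) = aget≡vat a p

marks⇔ : ∀ {m n} (T : Mat m n) (a : Vec ℕ (m + n ∸ 1)) →
  (∀ p → suc (aget a p) ≤ eta T (suc (toℕ p))) ⇔ (∀ q → q < m + n ∸ 1 → vat a q < eta T (suc q))
marks⇔ T a = mk⇔
  (λ f q q< → subst (λ w → vat a w < eta T (suc w)) (toℕ-fromℕ< q<)
     (subst (_< eta T (suc (toℕ (fromℕ< q<)))) (aget≡vat a (fromℕ< q<)) (f (fromℕ< q<))))
  (λ g p → subst (_< eta T (suc (toℕ p))) (sym (aget≡vat a p)) (g (toℕ p) (toℕ<n p)))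

suc-∸1 : ∀ {k} → 0 < k → suc (k ∸ 1) ≡ k
suc-∸1 = m+[n∸m]≡n

module Index {m n : ℕ} (0<m : 0 < m) where

  row-index : ∀ {q} → suc q < m → q < m + n ∸ 1
  row-index {q} l = ≤-pred (≤-trans (≤-trans l (m≤m+n m n)) (≤-reflexive (sym (suc-∸1 (≤-trans 0<m (m≤m+n m n))))))

  col-suc : ∀ y → suc (m + y ∸ 1) ≡ m + y
  col-suc y = suc-∸1 (≤-trans 0<m (m≤m+n m y))

  col-index : ∀ {y} → y < n → m + y ∸ 1 < m + n ∸ 1
  col-index {y} l = ≤-pred (subst₂ _<_ (sym (col-suc y)) (sym (col-suc n)) (+-monoʳ-< m l))

  split : ∀ q → q < m + n ∸ 1 → suc q < m ⊎ (∃ λ y → y < n × q ≡ m + y ∸ 1)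
  split q q< with ≤-<-connex m (suc q)
  ... | inj₂ l = inj₁ l
  ... | inj₁ l = inj₂ (suc q ∸ m
      , +-cancelˡ-< m _ _ (subst₂ _<_ (sym (m+[n∸m]≡n l)) (col-suc n) (s≤s q<))
      , cong (_∸ 1) (sym (m+[n∸m]≡n l)))

-- Here `s` is the next smaller size and `f` is `η`. Since `a < f`, the truncated subtractions are
-- exact and `size ∸ 1` is `(f ∸ a ∸ 1) + (s + a)`.
surplus⇔ : ∀ {size s f a start} → s + f ≡ size → a < f →
  (ℤ.+ (size ∸ 1)) ℤ.- (ℤ.+ start) ≡ ℤ.+ (f ∸ a ∸ 1) ⇔ start ≡ s + a
surplus⇔ {_} {s} {f} {a} {start} refl a<f = mk⇔ fwd bwd
  where
  d : ℕ
  d = f ∸ a ∸ 1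
  f≡ : a + suc d ≡ f
  f≡ = trans (cong (a +_) (suc-∸1 (m<n⇒0<n∸m a<f))) (m+[n∸m]≡n (<⇒≤ a<f))
  size-1 : s + f ∸ 1 ≡ d + (s + a)
  size-1 = trans (cong (λ w → s + w ∸ 1) (trans (sym f≡) (+-suc a d)))
          (trans (cong (_∸ 1) (+-suc s (a + d))) (trans (sym (+-assoc s a d)) (+-comm (s + a) d)))
  fwd : (ℤ.+ (s + f ∸ 1)) ℤ.- (ℤ.+ start) ≡ ℤ.+ d → start ≡ s + a
  fwd e = +-cancelˡ-≡ d start (s + a) (trans (sym (ℤ.+-injective
    (trans (sym (//-rightDividesˡ (ℤ.+ start) (ℤ.+ (s + f ∸ 1)))) (cong (λ w → w ℤ.+ (ℤ.+ start)) e)))) size-1)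
  bwd : start ≡ s + a → (ℤ.+ (s + f ∸ 1)) ℤ.- (ℤ.+ start) ≡ ℤ.+ d
  bwd refl = trans (cong (λ w → (ℤ.+ w) ℤ.- (ℤ.+ (s + a))) size-1) (//-rightDividesʳ (ℤ.+ (s + a)) (ℤ.+ d))

compatible-cong : ∀ {m n} {T : Mat m n} {L L' U U'} → 0 < m → (∀ x → x < m → L x ≡ L' x) → (∀ y → y < n → U y ≡ U' y)
  → Compatible T L U → Compatible T L' U'
compatible-cong 0<m eL eU comp = record
  { L-root = trans (sym (eL 0 0<m)) L-root
  ; L<zeros = λ 1≤x x< → subst (_< _) (eL _ x<) (L<zeros 1≤x x<)
  ; zeros≤L = λ 1≤x x< x'< lt → subst (_ ≤_) (eL _ x<) (zeros≤L 1≤x x< x'< lt)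
  ; U<ones = λ y< → subst (_< _) (eU _ y<) (U<ones y<)
  ; ones≤U = λ y< y'< lt → subst (_ ≤_) (eU _ y<) (ones≤U y< y'< lt)
  }
  where open Compatible comp

module Bijection (m n : ℕ) (0<m : 0 < m) (0<n : 0 < n) where
  open Index {m} {n} 0<m

  Φ : MEW m n → LabPoly m n
  Φ (M , _) = sortedPoly (rowKey M) (colKey M)

  module OfMarked (M : MEW m n) where
    T : Mat m n
    T = proj₁ (proj₁ M)
    a : Vec ℕ (m + n ∸ 1)
    a = proj₂ (proj₁ M)
    ew : IsEW T
    ew = proj₁ (proj₂ M)
    open EW T ew

    L U : ℕ → ℕ
    L = rowKey (proj₁ M)
    U = colKey (proj₁ M)

    marks : ∀ q → q < m + n ∸ 1 → vat a q < eta T (suc q)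
    marks = to (marks⇔ T a) (proj₂ (proj₂ M))

    row-mark : ∀ {q} → suc q < m → vat a q < rowFree T (suc q)
    row-mark {q} l = subst (vat a q <_) (eta-row T (s≤s z≤n) l) (marks q (row-index l))

    col-mark : ∀ {y} → y < n → vat a (m + y ∸ 1) < colFree T y
    col-mark {y} y< = subst (vat a (m + y ∸ 1) <_) (trans (cong (eta T) (col-suc y)) (eta-col T y<)) (marks _ (col-index y<))

    compatible : Compatible T L U
    compatible = record
      { L-root = refl
      ; L<zeros = λ { {suc q} _ x< → <-≤-trans (+-monoʳ-< (rowFixed T (suc q)) (row-mark x<)) (≤-reflexive (rowFixed+rowFree T (suc q))) }
      ; zeros≤L = λ { {suc q} _ x< x'< lt → ≤-trans (Row.size≤smaller x< x'< lt) (m≤m+n _ _) }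
      ; U<ones = λ {y} y< → <-≤-trans (+-monoʳ-< (colFixed T y) (col-mark y<)) (≤-reflexive (colFixed+colFree T y))
      ; ones≤U = λ y< y'< lt → ≤-trans (Col.size≤smaller y< y'< lt) (m≤m+n _ _)
      }

    open Realise 0<m 0<n T ew compatible public using (D; E; D-para; D-bounce; D-phi; rowStart-D; colStart-D)

    module _ (D' E' : LabPoly m n) (phi : IsPhi T E') where
      open Surplus 0<m 0<n T ew D' E' phi

      row-surplus⇔ : ∀ {q} → suc q < m →
        surp D' E' (suc q) ≡ ℤ.+ (eta T (suc q) ∸ vat a q ∸ 1) ⇔ rowStart D' (suc q) ≡ L (suc q)
      row-surplus⇔ {q} l = subst₂ (λ v w → v ≡ ℤ.+ (w ∸ vat a q ∸ 1) ⇔ rowStart D' (suc q) ≡ L (suc q))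
        (sym (surp-row (suc q) l)) (sym (eta-row T (s≤s z≤n) l))
        (surplus⇔ (rowFixed+rowFree T (suc q)) (row-mark l))

      col-surplus⇔ : ∀ {y} → y < n →
        surp D' E' (suc (m + y ∸ 1)) ≡ ℤ.+ (eta T (suc (m + y ∸ 1)) ∸ vat a (m + y ∸ 1) ∸ 1) ⇔ colStart D' y ≡ U y
      col-surplus⇔ {y} y< = subst (λ v → surp D' E' v ≡ ℤ.+ (eta T v ∸ vat a (m + y ∸ 1) ∸ 1) ⇔ colStart D' y ≡ U y)
        (sym (col-suc y))
        (subst₂ (λ v w → v ≡ ℤ.+ (w ∸ vat a (m + y ∸ 1) ∸ 1) ⇔ colStart D' y ≡ U y)
          (sym (surp-col y y<)) (sym (eta-col T y<))
          (surplus⇔ (colFixed+colFree T y) (col-mark y<)))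

    spec : Spec (proj₁ M) D
    spec = E , D-bounce , D-phi , λ p → trans (surplus (toℕ p) (toℕ<n p))
        (cong (λ w → ℤ.+ (eta T (suc (toℕ p)) ∸ w ∸ 1)) (sym (aget≡vat a p)))
      where
      surplus : ∀ q → q < m + n ∸ 1 → surp D E (suc q) ≡ ℤ.+ (eta T (suc q) ∸ vat a q ∸ 1)
      surplus q q< with split q q<
      ... | inj₁ l = from (row-surplus⇔ D E D-phi l) (rowStart-D (suc q) l)
      ... | inj₂ (y , y< , refl) = from (col-surplus⇔ D E D-phi y<) (colStart-D y y<)

    -- The surplus equations translate into the starts of `D'`, and `para-unique` rebuilds the
    -- labelled polyomino from them.
    spec-unique : ∀ D' → IsLPara D' → Spec (proj₁ M) D' → D' ≡ D
    spec-unique D' para (E' , _ , phi , sur) = para-unique 0<m 0<n D' para rows cols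
      where
      surplus : ∀ q → q < m + n ∸ 1 → surp D' E' (suc q) ≡ ℤ.+ (eta T (suc q) ∸ vat a q ∸ 1)
      surplus q q< = subst (λ w → surp D' E' (suc w) ≡ ℤ.+ (eta T (suc w) ∸ vat a w ∸ 1)) (toℕ-fromℕ< q<)
        (trans (sur (fromℕ< q<)) (cong (λ w → ℤ.+ (eta T (suc (toℕ (fromℕ< q<))) ∸ w ∸ 1)) (aget≡vat a (fromℕ< q<))))
      rows : ∀ x → x < m → rowStart D' x ≡ L x
      rows zero    _ = ParaStarts.rowStart-root 0<m 0<n D' para
      rows (suc q) l = to (row-surplus⇔ D' E' phi l) (surplus q (row-index l))
      cols : ∀ y → y < n → colStart D' y ≡ U y
      cols y y< = to (col-surplus⇔ D' E' phi y<) (surplus (m + y ∸ 1) (col-index y<))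

  -- Both tableaux are compatible with the starts of the one polyomino `Φ M`, so both equal its
  -- burnt tableau. The cornersupport counts then agree and cancel from the keys, leaving the marks.
  Φ-injective : ∀ M M' → Φ M ≡ Φ M' → proj₁ M ≡ proj₁ M'
  Φ-injective M M' e = finish T≡
    where
    module A = OfMarked M
    module A' = OfMarked M'
    open ParaStarts 0<m 0<n (Φ M) A.D-para
    L≡ : ∀ x → x < m → A.L x ≡ A'.L x
    L≡ x x< = trans (sym (A.rowStart-D x x<)) (trans (cong (λ w → rowStart w x) e) (A'.rowStart-D x x<))
    U≡ : ∀ y → y < n → A.U y ≡ A'.U y
    U≡ y y< = trans (sym (A.colStart-D y y<)) (trans (cong (λ w → colStart w y) e) (A'.colStart-D y y<))
    T≡ : A.T ≡ A'.T
    T≡ = trans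
      (compatible-unique A.T A.ew (compatible-cong 0<m (λ x x< → sym (A.rowStart-D x x<)) (λ y y< → sym (A.colStart-D y y<)) A.compatible))
      (sym (compatible-unique A'.T A'.ew (compatible-cong 0<m
        (λ x x< → sym (trans (A.rowStart-D x x<) (L≡ x x<))) (λ y y< → sym (trans (A.colStart-D y y<) (U≡ y y<))) A'.compatible)))
    finish : A.T ≡ A'.T → proj₁ M ≡ proj₁ M'
    finish q = cong₂ _,_ q (vget-ext 0 A.a A'.a same)
      where
      same : ∀ i → i < m + n ∸ 1 → vat A.a i ≡ vat A'.a i
      same i i< with split i i<
      ... | inj₁ l = +-cancelˡ-≡ (rowFixed A.T (suc i)) _ _
                       (trans (L≡ (suc i) l) (cong (λ w → rowFixed w (suc i) + vat A'.a i) (sym q)))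
      ... | inj₂ (y , y< , refl) = +-cancelˡ-≡ (colFixed A.T y) _ _
                       (trans (U≡ y y<) (cong (λ w → colFixed w y + vat A'.a (m + y ∸ 1)) (sym q)))

  -- The tableau comes from burning with the starts of `D`, and each mark is the height of the start
  -- above the next smaller size. `smaller≤` makes this difference nonnegative, and `L<zeros` and
  -- `U<ones` keep it below `η`.
  Φ-surjective : ∀ D → IsLPara D → Σ (MEW m n) λ M → Φ M ≡ D
  Φ-surjective D para = ((T , a) , burnt-ew , from (marks⇔ T a) marks) , sym (para-unique 0<m 0<n D para rows cols)
    where
    open ParaStarts 0<m 0<n D para
    L U : ℕ → ℕ
    L = rowStart D
    U = colStart D
    T : Mat m n
    T = Burning.burnt m n 0<m 0<n L U
    open Compatible (burnt-compatible rowStart-root)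
    open EW T burnt-ew
    mark : ℕ → ℕ
    mark q = if suc q <ᵇ m then L (suc q) ∸ rowFixed T (suc q) else U (suc q ∸ m) ∸ colFixed T (suc q ∸ m)
    a : Vec ℕ (m + n ∸ 1)
    a = tabulate (mark ∘ toℕ)
    rowFixed≤ : ∀ {x} → 1 ≤ x → x < m → rowFixed T x ≤ L x
    rowFixed≤ 1≤x x< = Row.smaller≤ x< (zeros≤L 1≤x x<)
    colFixed≤ : ∀ {y} → y < n → colFixed T y ≤ U y
    colFixed≤ y< = Col.smaller≤ y< (ones≤U y<)
    row-mark : ∀ q → suc q < m → vat a q ≡ L (suc q) ∸ rowFixed T (suc q)
    row-mark q l = trans (vget-tabulate 0 mark q (row-index l))
      (cong (λ b → if b then L (suc q) ∸ rowFixed T (suc q) else U (suc q ∸ m) ∸ colFixed T (suc q ∸ m)) (from (<ᵇ⇔ {suc q} {m}) l))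
    col-mark : ∀ y → y < n → vat a (m + y ∸ 1) ≡ U y ∸ colFixed T y
    col-mark y y< = trans (vget-tabulate 0 mark (m + y ∸ 1) (col-index y<)) (trans
      (cong (λ w → if w <ᵇ m then L w ∸ rowFixed T w else U (w ∸ m) ∸ colFixed T (w ∸ m)) (col-suc y))
      (trans (cong (λ b → if b then L (m + y) ∸ rowFixed T (m + y) else U (m + y ∸ m) ∸ colFixed T (m + y ∸ m))
                (¬true⇒false (λ e → m+n≮m m y (to (<ᵇ⇔ {m + y} {m}) e))))
             (cong (λ w → U w ∸ colFixed T w) (m+n∸m≡n m y))))
    rows : ∀ x → x < m → rowStart D x ≡ rowKey (T , a) x
    rows zero    _ = rowStart-root
    rows (suc q) l = sym (trans (cong (rowFixed T (suc q) +_) (row-mark q l)) (m+[n∸m]≡n (rowFixed≤ (s≤s z≤n) l)))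
    cols : ∀ y → y < n → colStart D y ≡ colKey (T , a) y
    cols y y< = sym (trans (cong (colFixed T y +_) (col-mark y y<)) (m+[n∸m]≡n (colFixed≤ y<)))
    marks : ∀ q → q < m + n ∸ 1 → vat a q < eta T (suc q)
    marks q q< with split q q<
    ... | inj₁ l = subst (vat a q <_) (sym (eta-row T (s≤s z≤n) l)) (+-cancelˡ-< (rowFixed T (suc q)) _ _
            (subst₂ _<_ (rows (suc q) l) (sym (rowFixed+rowFree T (suc q))) (L<zeros (s≤s z≤n) l)))
    ... | inj₂ (y , y< , refl) = subst (vat a q <_) (sym (trans (cong (eta T) (col-suc y)) (eta-col T y<)))
            (+-cancelˡ-< (colFixed T y) _ _ (subst₂ _<_ (cols y y<) (sym (colFixed+colFree T y)) (U<ones y<)))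

theorem4p6 : ∀ (m n : ℕ) → 1 ≤ m → 1 ≤ n →
    Σ (MEW m n → LabPoly m n) λ Φ →
    (∀ (M : MEW m n) →
    IsLPara (Φ M) × Spec (proj₁ M) (Φ M)
    × (∀ (D : LabPoly m n) → IsLPara D → Spec (proj₁ M) D → D ≡ Φ M))
    × (∀ (M M' : MEW m n) → Φ M ≡ Φ M' → proj₁ M ≡ proj₁ M')
    × (∀ (D : LabPoly m n) → IsLPara D → Σ (MEW m n) λ M → Φ M ≡ D)
theorem4p6 m n 0<m 0<n = Φ , (λ M → D-para M , spec M , spec-unique M) , Φ-injective , Φ-surjective
  where
  open Bijection m n 0<m 0<n
  open OfMarked
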